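{- Let $G$ be a finite abelian group with $n$ elements, and let $S\subseteq G$ be a generating set of $G$ with $S=-S$ and $0_G\notin S$. Let $p$ be the smallest prime factor of $n$. (1) If $p=3$, then $c(\mathrm{Cay}(G,S))\le \sqrt{\dfrac{3}{2(\sqrt{3}-1)\,e}}\,\sqrt{n}+\dfrac72$. (2) If $p\ge 5$, then $c(\mathrm{Cay}(G,S))\le \sqrt{\dfrac{2}{e}}\,\sqrt{n}+\dfrac72$.
   Context: Cops and robbers is played on a finite connected graph. First each cop chooses a starting vertex, then the robber chooses a starting vertex. Then cop turns and robber turns alternate, starting with a cop turn. On a cop turn each cop moves to a neighbouring vertex or stays where it is; on a robber turn the robber does likewise. Several cops may share a vertex, and all players have full information. The cops win if at some point a cop shares a vertex with the robber; the robber wins if this never happens. The cop number $c(\Gamma)$ is the minimum number of cops for which the cops have a winning strategy on $\Gamma$. For a finite abelian group $(G,+)$ and a generating set $S$ with $0_G\notin S$ and $S=-S$, $\mathrm{Cay}(G,S)$ is the undirected graph with vertex set $G$ in which $u,v$ are adjacent iff $v-u\in S$. Here $e$ is the base of the natural logarithm. -}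

module Defs where

open import Level using (Level; _⊔_) renaming (suc to lsuc)
open import Algebra.Bundles using (AbelianGroup)
open import Data.Bool using (if_then_else_)
open import Data.Empty using (⊥-elim)
open import Data.Fin using (Fin)
open import Data.Integer as ℤ using (+_; +[1+_])
import Data.Integer.Properties as ℤ
open import Data.List using (List; []; _∷_)
open import Data.Nat as ℕ using (ℕ; zero; suc; _!)
open import Data.Nat.Divisibility using (_∣_)
open import Data.Nat.Primality using (Prime)
import Data.Nat.Properties as ℕ
open import Data.Product using (∃-syntax; _×_; _,_; proj₁)
open import Data.Rational as ℚ using (ℚ; mkℚ; 0ℚ; 1ℚ; ½; _+_; _*_; -_; _-_; 1/_; _/_; _≤_; _<_; ∣_∣; ↥_)
open import Data.Rational.Properties
open import Data.Rational.Solver using (module +-*-Solver)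
import Data.Rational.Unnormalised as ℚᵘ
import Data.Rational.Unnormalised.Properties as ℚᵘ
open import Data.Sum using (_⊎_; inj₁; inj₂; map₁)
open import Relation.Binary using (Rel; Setoid; Symmetric; _Respects_; _Respects₂_)
open import Relation.Binary.PropositionalEquality using (_≡_; refl; sym; trans; cong; cong₂; subst; subst₂)
open import Relation.Nullary using (¬_; Dec; yes; no; does)
open import Relation.Unary using (Pred; _∈_; _∉_; _≐_)

open +-*-Solver using (solve; _:=_; _:+_; _:*_; _:-_; :-_; con)

module RationalLemmas where
  frac-mono : ∀ i j m n .{{_ : ℕ.NonZero m}} .{{_ : ℕ.NonZero n}} → i ℕ.* n ℕ.≤ j ℕ.* m → (+ i / m) ≤ (+ j / n)
  frac-mono i j (suc m) (suc n) h = toℚᵘ-cancel-≤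
    (ℚᵘ.≤-respˡ-≃ (ℚᵘ.≃-sym (toℚᵘ-fromℚᵘ (ℚᵘ.mkℚᵘ (+ i) m)))
      (ℚᵘ.≤-respʳ-≃ (ℚᵘ.≃-sym (toℚᵘ-fromℚᵘ (ℚᵘ.mkℚᵘ (+ j) n)))
        (ℚᵘ.*≤* (subst₂ ℤ._≤_ (ℤ.pos-* i (suc n)) (ℤ.pos-* j (suc m)) (ℤ.+≤+ h)))))

  frac-+ : ∀ i j m .{{_ : ℕ.NonZero m}} → + (i ℕ.+ j) / m ≡ (+ i / m) + (+ j / m)
  frac-+ i j (suc m) = sym (toℚᵘ-injective
    (ℚᵘ.≃-trans (toℚᵘ-homo-+ (+ i / suc m) (+ j / suc m))
    (ℚᵘ.≃-trans (ℚᵘ.+-cong (toℚᵘ-fromℚᵘ (ℚᵘ.mkℚᵘ (+ i) m)) (toℚᵘ-fromℚᵘ (ℚᵘ.mkℚᵘ (+ j) m)))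
    (ℚᵘ.≃-trans (ℚᵘ.*≡* (lem (+ i) (+ j) (+ suc m)))
      (ℚᵘ.≃-sym (toℚᵘ-fromℚᵘ (ℚᵘ.mkℚᵘ (+ (i ℕ.+ j)) m)))))))
    where
    open import Data.Integer.Solver renaming (module +-*-Solver to ℤS)
    lem : ∀ x y d → (x ℤ.* d ℤ.+ y ℤ.* d) ℤ.* d ≡ (x ℤ.+ y) ℤ.* (d ℤ.* d)
    lem = ℤS.solve 3 (λ x y d → (x ℤS.:* d ℤS.:+ y ℤS.:* d) ℤS.:* d ℤS.:= (x ℤS.:+ y) ℤS.:* (d ℤS.:* d)) refl

  frac-≥0 : ∀ i m .{{_ : ℕ.NonZero m}} → 0ℚ ≤ + i / m
  frac-≥0 i m = frac-mono 0 i 1 m ℕ.z≤n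

  *-mono-≤ : ∀ {p q r t} → 0ℚ ≤ p → p ≤ q → 0ℚ ≤ r → r ≤ t → p * r ≤ q * t
  *-mono-≤ {p} {q} {r} {t} 0≤p p≤q 0≤r r≤t = ≤-trans
    (*-monoʳ-≤-nonNeg r {{ℚ.nonNegative 0≤r}} p≤q)
    (*-monoˡ-≤-nonNeg q {{ℚ.nonNegative (≤-trans 0≤p p≤q)}} r≤t)

  0≤* : ∀ {p q} → 0ℚ ≤ p → 0ℚ ≤ q → 0ℚ ≤ p * q
  0≤* {p} 0≤p 0≤q = *-mono-≤ {0ℚ} {p} {0ℚ} ≤-refl 0≤p ≤-refl 0≤q

  0<* : ∀ {p q} → 0ℚ < p → 0ℚ < q → 0ℚ < p * q
  0<* {p} {q} 0<p 0<q = subst (_< p * q) (*-zeroˡ q) (*-monoˡ-<-pos q {{ℚ.positive 0<q}} 0<p)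

  0<½ : 0ℚ < ½
  0<½ = positive⁻¹ ½

  0<1 : 0ℚ < 1ℚ
  0<1 = positive⁻¹ 1ℚ

  0<∣∣+1 : ∀ p → 0ℚ < ∣ p ∣ + 1ℚ
  0<∣∣+1 p = +-mono-≤-< (0≤∣p∣ p) 0<1

  ½+½ : ∀ p → ½ * p + ½ * p ≡ p
  ½+½ = solve 1 (λ p → con ½ :* p :+ con ½ :* p := p) refl

  ≤∣∣ : ∀ p → p ≤ ∣ p ∣
  ≤∣∣ p with ≤-total 0ℚ p
  ... | inj₁ 0≤p = ≤-reflexive (sym (0≤p⇒∣p∣≡p 0≤p))
  ... | inj₂ p≤0 = ≤-trans p≤0 (0≤∣p∣ p)

  close⇒≤ : ∀ {p q ε} → ∣ p - q ∣ ≤ ε → p ≤ q + ε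
  close⇒≤ {p} {q} {ε} h = subst (_≤ q + ε) (solve 2 (λ p q → q :+ (p :- q) := p) refl p q)
    (+-monoʳ-≤ q (≤-trans (≤∣∣ (p - q)) h))

  ≤⇒diff : ∀ {p q ε} → p ≤ q + ε → p - q ≤ ε
  ≤⇒diff {p} {q} {ε} h = subst (p - q ≤_) (solve 2 (λ q ε → q :+ ε :- q := ε) refl q ε) (+-monoˡ-≤ (- q) h)

  ≤⇒close : ∀ {p q ε} → p ≤ q + ε → q ≤ p + ε → ∣ p - q ∣ ≤ ε
  ≤⇒close {p} {q} {ε} h k with ∣p∣≡p∨∣p∣≡-p (p - q)
  ... | inj₁ e = subst (_≤ ε) (sym e) (≤⇒diff h)
  ... | inj₂ e = subst (_≤ ε) (sym (trans e (solve 2 (λ p q → :- (p :- q) := q :- p) refl p q))) (≤⇒diff k)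

  0≢ : ∀ {p} → 0ℚ < p → ¬ p ≡ 0ℚ
  0≢ 0<p refl = <-irrefl refl 0<p

  archimedean : ∀ ε → 0ℚ < ε → ∃[ N ] (∀ m → N ℕ.≤ m → (+ 1 / suc m) ≤ ε)
  archimedean ε@(mkℚ +[1+ k ] d _) _ = d , λ m d≤m → subst ((+ 1 / suc m) ≤_) (fromℚᵘ-toℚᵘ ε)
    (frac-mono 1 (suc k) (suc m) (suc d)
      (ℕ.≤-trans (ℕ.≤-reflexive (ℕ.*-identityˡ (suc d)))
        (ℕ.≤-trans (ℕ.s≤s d≤m) (ℕ.m≤m+n (suc m) (k ℕ.* suc m)))))
  archimedean (mkℚ (+ 0) d _) (ℚ.*<* (ℤ.+<+ ()))
  archimedean (mkℚ (ℤ.-[1+ _ ]) d _) (ℚ.*<* ())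

open RationalLemmas

Cauchy : (ℕ → ℚ) → Set
Cauchy x = ∀ ε → 0ℚ < ε → ∃[ N ] (∀ m n → N ℕ.≤ m → N ℕ.≤ n → ∣ x m - x n ∣ ≤ ε)

record ℝ : Set where
  no-eta-equality
  field
    seq    : ℕ → ℚ
    cauchy : Cauchy seq

open ℝ public

infix 4 _≤ℝ_

_≤ℝ_ : ℝ → ℝ → Set
x ≤ℝ y = ∀ ε → 0ℚ < ε → ∃[ N ] (∀ m → N ℕ.≤ m → seq x m ≤ seq y m + ε)

-- x > 0
record Positiveℝ (x : ℝ) : Set where
  no-eta-equality
  field
    bound   : ℚ
    0<bound : 0ℚ < bound
    from    : ℕ
    bounded : ∀ m → from ℕ.≤ m → bound ≤ seq x m

open Positiveℝ

fromℚ : ℚ → ℝ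
fromℚ q .seq _ = q
fromℚ q .cauchy ε 0<ε = 0 , λ _ _ _ _ → subst (λ z → ∣ z ∣ ≤ ε) (sym (+-inverseʳ q)) (<⇒≤ 0<ε)

fromℕ : ℕ → ℝ
fromℕ n = fromℚ (+ n / 1)

infixl 6 _+ℝ_ _-ℝ_
infixl 7 _*ℝ_ _÷ℝ_
infix  8 -ℝ_

_+ℝ_ : ℝ → ℝ → ℝ
(x +ℝ y) .seq m = seq x m + seq y m
(x +ℝ y) .cauchy ε 0<ε with cauchy x (½ * ε) (0<* 0<½ 0<ε) | cauchy y (½ * ε) (0<* 0<½ 0<ε)
... | N , f | M , g = N ℕ.⊔ M , λ m n N≤m N≤n → begin
  ∣ (seq x m + seq y m) - (seq x n + seq y n) ∣
    ≡⟨ cong ∣_∣ (solve 4 (λ p q r t → (p :+ q) :- (r :+ t) := (p :- r) :+ (q :- t)) refl (seq x m) (seq y m) (seq x n) (seq y n)) ⟩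
  ∣ (seq x m - seq x n) + (seq y m - seq y n) ∣
    ≤⟨ ∣p+q∣≤∣p∣+∣q∣ (seq x m - seq x n) (seq y m - seq y n) ⟩
  ∣ seq x m - seq x n ∣ + ∣ seq y m - seq y n ∣
    ≤⟨ +-mono-≤ (f m n (ℕ.m⊔n≤o⇒m≤o N M N≤m) (ℕ.m⊔n≤o⇒m≤o N M N≤n))
                (g m n (ℕ.m⊔n≤o⇒n≤o N M N≤m) (ℕ.m⊔n≤o⇒n≤o N M N≤n)) ⟩
  ½ * ε + ½ * ε ≡⟨ ½+½ ε ⟩
  ε ∎
  where open ≤-Reasoning

-ℝ_ : ℝ → ℝ
(-ℝ x) .seq m = - seq x m
(-ℝ x) .cauchy ε 0<ε with cauchy x ε 0<ε
... | N , f = N , λ m n N≤m N≤n → subst (_≤ ε)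
  (trans (sym (∣-p∣≡∣p∣ (seq x m - seq x n)))
    (cong ∣_∣ (solve 2 (λ p q → :- (p :- q) := :- p :- (:- q)) refl (seq x m) (seq x n))))
  (f m n N≤m N≤n)

_-ℝ_ : ℝ → ℝ → ℝ
x -ℝ y = x +ℝ (-ℝ y)

module BoundLemmas where
  eventually-bounded : (x : ℝ) → ∃[ B ] (0ℚ < B × ∃[ N ] (∀ m → N ℕ.≤ m → ∣ seq x m ∣ ≤ B))
  eventually-bounded x with cauchy x 1ℚ 0<1
  ... | N , f = ∣ seq x N ∣ + 1ℚ , 0<∣∣+1 (seq x N) , N , λ m N≤m → begin
    ∣ seq x m ∣                           ≡⟨ cong ∣_∣ (solve 2 (λ p q → p := q :+ (p :- q)) refl (seq x m) (seq x N)) ⟩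
    ∣ seq x N + (seq x m - seq x N) ∣     ≤⟨ ∣p+q∣≤∣p∣+∣q∣ (seq x N) (seq x m - seq x N) ⟩
    ∣ seq x N ∣ + ∣ seq x m - seq x N ∣   ≤⟨ +-monoʳ-≤ ∣ seq x N ∣ (f m N N≤m ℕ.≤-refl) ⟩
    ∣ seq x N ∣ + 1ℚ                      ∎
    where open ≤-Reasoning

  *-close : ∀ {p q p′ q′ B C 1/B 1/C η} → ∣ p ∣ ≤ B → ∣ q′ ∣ ≤ C →
            ∣ p - p′ ∣ ≤ η * 1/C → ∣ q - q′ ∣ ≤ η * 1/B → 1/B * B ≡ 1ℚ → 1/C * C ≡ 1ℚ →
            ∣ p * q - p′ * q′ ∣ ≤ η + η
  *-close {p} {q} {p′} {q′} {B} {C} {1/B} {1/C} {η} p≤B q′≤C hp hq 1/B*B 1/C*C = begin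
    ∣ p * q - p′ * q′ ∣
      ≡⟨ cong ∣_∣ (solve 4 (λ p q r t → p :* q :- r :* t := p :* (q :- t) :+ (p :- r) :* t) refl p q p′ q′) ⟩
    ∣ p * (q - q′) + (p - p′) * q′ ∣
      ≤⟨ ∣p+q∣≤∣p∣+∣q∣ (p * (q - q′)) ((p - p′) * q′) ⟩
    ∣ p * (q - q′) ∣ + ∣ (p - p′) * q′ ∣
      ≡⟨ cong₂ _+_ (∣p*q∣≡∣p∣*∣q∣ p (q - q′)) (∣p*q∣≡∣p∣*∣q∣ (p - p′) q′) ⟩
    ∣ p ∣ * ∣ q - q′ ∣ + ∣ p - p′ ∣ * ∣ q′ ∣
      ≤⟨ +-mono-≤ (*-mono-≤ (0≤∣p∣ p) p≤B (0≤∣p∣ (q - q′)) hq) (*-mono-≤ (0≤∣p∣ (p - p′)) hp (0≤∣p∣ q′) q′≤C) ⟩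
    B * (η * 1/B) + η * 1/C * C
      ≡⟨ cong₂ _+_ (solve 3 (λ B η r → B :* (η :* r) := η :* (r :* B)) refl B η 1/B) (*-assoc η 1/C C) ⟩
    η * (1/B * B) + η * (1/C * C)
      ≡⟨ cong₂ (λ x y → η * x + η * y) 1/B*B 1/C*C ⟩
    η * 1ℚ + η * 1ℚ
      ≡⟨ cong₂ _+_ (*-identityʳ η) (*-identityʳ η) ⟩
    η + η ∎
    where open ≤-Reasoning

  reciprocal : ∀ p → 0ℚ < p → ∃[ r ] (0ℚ < r × r * p ≡ 1ℚ)
  reciprocal p 0<p = (1/ p) {{ℚ.>-nonZero 0<p}} , positive⁻¹ _ {{1/pos⇒pos p {{ℚ.positive 0<p}}}} , *-inverseˡ p {{ℚ.>-nonZero 0<p}}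

open BoundLemmas

_*ℝ_ : ℝ → ℝ → ℝ
(x *ℝ y) .seq m = seq x m * seq y m
(x *ℝ y) .cauchy ε 0<ε =
  let (B , 0<B , N₁ , f₁) = eventually-bounded x
      (C , 0<C , N₂ , f₂) = eventually-bounded y
      (1/B , 0<1/B , 1/B*B) = reciprocal B 0<B
      (1/C , 0<1/C , 1/C*C) = reciprocal C 0<C
      (N₃ , f₃) = cauchy x (½ * ε * 1/C) (0<* (0<* 0<½ 0<ε) 0<1/C)
      (N₄ , f₄) = cauchy y (½ * ε * 1/B) (0<* (0<* 0<½ 0<ε) 0<1/B)
      N = (N₁ ℕ.⊔ N₂) ℕ.⊔ (N₃ ℕ.⊔ N₄)
      l = λ {k} (h : N ℕ.≤ k) → ℕ.m⊔n≤o⇒m≤o (N₁ ℕ.⊔ N₂) (N₃ ℕ.⊔ N₄) h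
      r = λ {k} (h : N ℕ.≤ k) → ℕ.m⊔n≤o⇒n≤o (N₁ ℕ.⊔ N₂) (N₃ ℕ.⊔ N₄) h
  in N , λ m n N≤m N≤n → subst (∣ seq x m * seq y m - seq x n * seq y n ∣ ≤_) (½+½ ε)
    (*-close {B = B} {C} {1/B} {1/C} {½ * ε} (f₁ m (ℕ.m⊔n≤o⇒m≤o N₁ N₂ (l N≤m))) (f₂ n (ℕ.m⊔n≤o⇒n≤o N₁ N₂ (l N≤n)))
      (f₃ m n (ℕ.m⊔n≤o⇒m≤o N₃ N₄ (r N≤m)) (ℕ.m⊔n≤o⇒m≤o N₃ N₄ (r N≤n)))
      (f₄ m n (ℕ.m⊔n≤o⇒n≤o N₃ N₄ (r N≤m)) (ℕ.m⊔n≤o⇒n≤o N₃ N₄ (r N≤n)))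
      1/B*B 1/C*C)

-- The value at 0 is immaterial: a positive real has only finitely many zero terms.
recip : ℚ → ℚ
recip q with q ≟ 0ℚ
... | yes _   = 0ℚ
... | no  q≢0 = (1/ q) {{ℚ.≢-nonZero q≢0}}

module RecipLemmas where
  recip-inverse : ∀ q → 0ℚ < q → recip q * q ≡ 1ℚ
  recip-inverse q 0<q with q ≟ 0ℚ
  ... | yes q≡0 = ⊥-elim (0≢ 0<q q≡0)
  ... | no  q≢0 = *-inverseˡ q {{ℚ.≢-nonZero q≢0}}

  recip-≥0 : ∀ q → 0ℚ < q → 0ℚ ≤ recip q
  recip-≥0 q 0<q with q ≟ 0ℚ
  ... | yes q≡0 = ≤-refl
  ... | no  q≢0 = <⇒≤ (positive⁻¹ _ {{1/pos⇒pos q {{ℚ.positive 0<q}}}})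

  recip-antimono : ∀ p q → 0ℚ < p → p ≤ q → recip q ≤ recip p
  recip-antimono p q 0<p p≤q = subst₂ _≤_ lhs rhs
    (*-monoˡ-≤-nonNeg (recip p * recip q) {{ℚ.nonNegative (0≤* (recip-≥0 p 0<p) (recip-≥0 q 0<q))}} p≤q)
    where
    0<q = <-≤-trans 0<p p≤q
    lhs : recip p * recip q * p ≡ recip q
    lhs = trans (solve 3 (λ a b p → a :* b :* p := a :* p :* b) refl (recip p) (recip q) p)
      (trans (cong (_* recip q) (recip-inverse p 0<p)) (*-identityˡ (recip q)))
    rhs : recip p * recip q * q ≡ recip p
    rhs = trans (*-assoc (recip p) (recip q) q)
      (trans (cong (recip p *_) (recip-inverse q 0<q)) (*-identityʳ (recip p)))

open RecipLemmas

_⁻¹ℝ : (x : ℝ) → {{Positiveℝ x}} → ℝ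
(x ⁻¹ℝ) .seq m = recip (seq x m)
((x ⁻¹ℝ) {{x>0}}) .cauchy ε 0<ε with cauchy x (ε * (bound x>0 * bound x>0)) (0<* 0<ε (0<* (0<bound x>0) (0<bound x>0)))
... | N , f = from x>0 ℕ.⊔ N , λ m n N≤m N≤n → main (seq x m) (seq x n)
    (bounded x>0 m (ℕ.m⊔n≤o⇒m≤o (from x>0) N N≤m)) (bounded x>0 n (ℕ.m⊔n≤o⇒m≤o (from x>0) N N≤n))
    (f n m (ℕ.m⊔n≤o⇒n≤o (from x>0) N N≤n) (ℕ.m⊔n≤o⇒n≤o (from x>0) N N≤m))
  where
  open ≤-Reasoning
  δ = bound x>0
  0<δ = 0<bound x>0
  main : ∀ p q → δ ≤ p → δ ≤ q → ∣ q - p ∣ ≤ ε * (δ * δ) → ∣ recip p - recip q ∣ ≤ ε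
  main p q δ≤p δ≤q h = begin
    ∣ recip p - recip q ∣
      ≡⟨ cong ∣_∣ (sym (trans
           (solve 4 (λ p q a b → (q :- p) :* (a :* b) := (b :* q) :* a :- (a :* p) :* b) refl p q (recip p) (recip q))
           (cong₂ _-_ (trans (cong (_* recip p) (recip-inverse q 0<q)) (*-identityˡ (recip p)))
                      (trans (cong (_* recip q) (recip-inverse p 0<p)) (*-identityˡ (recip q)))))) ⟩
    ∣ (q - p) * (recip p * recip q) ∣
      ≡⟨ ∣p*q∣≡∣p∣*∣q∣ (q - p) (recip p * recip q) ⟩
    ∣ q - p ∣ * ∣ recip p * recip q ∣
      ≡⟨ cong (∣ q - p ∣ *_) (0≤p⇒∣p∣≡p 0≤rr) ⟩
    ∣ q - p ∣ * (recip p * recip q)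
      ≤⟨ *-mono-≤ (0≤∣p∣ (q - p)) h 0≤rr
           (*-mono-≤ (recip-≥0 p 0<p) (recip-antimono δ p 0<δ δ≤p) (recip-≥0 q 0<q) (recip-antimono δ q 0<δ δ≤q)) ⟩
    ε * (δ * δ) * (recip δ * recip δ)
      ≡⟨ solve 3 (λ ε d r → ε :* (d :* d) :* (r :* r) := ε :* ((r :* d) :* (r :* d))) refl ε δ (recip δ) ⟩
    ε * ((recip δ * δ) * (recip δ * δ))
      ≡⟨ cong (λ z → ε * (z * z)) (recip-inverse δ 0<δ) ⟩
    ε * 1ℚ
      ≡⟨ *-identityʳ ε ⟩
    ε ∎
    where
    0<p = <-≤-trans 0<δ δ≤p
    0<q = <-≤-trans 0<δ δ≤q
    0≤rr = 0≤* (recip-≥0 p 0<p) (recip-≥0 q 0<q)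

_÷ℝ_ : (x y : ℝ) → {{Positiveℝ y}} → ℝ
x ÷ℝ y = x *ℝ (y ⁻¹ℝ)

grid : ℕ → ℕ → ℚ
grid m j = + j / suc m

-- The largest j ≤ b with P j and j > 0, or 0 if there is none.
largest : {P : ℕ → Set} → (∀ j → Dec (P j)) → ℕ → ℕ
largest P? zero    = zero
largest P? (suc b) = if does (P? (suc b)) then suc b else largest P? b

-- For q ≥ 0, the largest multiple of 1 / (m + 1) whose square is at most q;
-- for q < 0, zero. The root of q is below the search limit, since
-- q < 1 + ∣↥ q∣ ≤ (1 + ∣↥ q∣)².
rootApprox : ℕ → ℚ → ℚ
rootApprox m q = grid m (largest (λ j → grid m j * grid m j ≤? q) (suc m ℕ.* suc ℤ.∣ ↥ q ∣))

module RootLemmas where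
  module _ {P : ℕ → Set} (P? : ∀ j → Dec (P j)) where
    largest-sound : ∀ b → largest P? b ≡ 0 ⊎ P (largest P? b)
    largest-sound zero = inj₁ refl
    largest-sound (suc b) with P? (suc b)
    ... | yes h = inj₂ h
    ... | no  _ = largest-sound b

    largest-max : ∀ b j → largest P? b ℕ.< j → j ℕ.≤ b → ¬ P j
    largest-max zero (suc j) _ ()
    largest-max (suc b) j r<j j≤b with P? (suc b)
    ... | yes _ = ⊥-elim (ℕ.<-irrefl refl (ℕ.≤-trans r<j j≤b))
    ... | no ¬h with ℕ.m≤n⇒m<n∨m≡n j≤b
    ...   | inj₁ j<1+b = largest-max b j r<j (ℕ.≤-pred j<1+b)
    ...   | inj₂ refl  = ¬h

    largest-≤ : ∀ b → largest P? b ℕ.≤ b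
    largest-≤ zero = ℕ.z≤n
    largest-≤ (suc b) with P? (suc b)
    ... | yes _ = ℕ.≤-refl
    ... | no  _ = ℕ.m≤n⇒m≤1+n (largest-≤ b)

    largest-next : ∀ b → ¬ b ≡ 0 → ¬ P b → ¬ P (suc (largest P? b))
    largest-next b b≢0 ¬Pb with ℕ.m≤n⇒m<n∨m≡n (largest-≤ b)
    ... | inj₁ r<b = largest-max b (suc (largest P? b)) ℕ.≤-refl r<b
    ... | inj₂ r≡b with largest-sound b
    ...   | inj₁ r≡0 = ⊥-elim (b≢0 (trans (sym r≡b) r≡0))
    ...   | inj₂ h   = ⊥-elim (¬Pb (subst P r≡b h))

  ≤-numerator : ∀ q → q ≤ + ℤ.∣ ↥ q ∣ / 1
  ≤-numerator q@(mkℚ (+ k) d _) = subst (_≤ + k / 1) (fromℚᵘ-toℚᵘ q)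
    (frac-mono k k (suc d) 1 (ℕ.*-monoʳ-≤ k {1} {suc d} (ℕ.s≤s ℕ.z≤n)))
  ≤-numerator q@(mkℚ (ℤ.-[1+ k ]) d _) = ≤-trans (<⇒≤ (negative⁻¹ q)) (frac-≥0 (suc k) 1)

  limit-large : ∀ m q → let g = grid m (suc m ℕ.* suc ℤ.∣ ↥ q ∣) in q < g * g
  limit-large m q = <-≤-trans q<g (subst (_≤ g * g) (*-identityˡ g) (*-mono-≤ (<⇒≤ 0<1) 1≤g (≤-trans (<⇒≤ 0<1) 1≤g) ≤-refl))
    where
    k = ℤ.∣ ↥ q ∣
    g = grid m (suc m ℕ.* suc k)
    1+k≤g : + suc k / 1 ≤ g
    1+k≤g = frac-mono (suc k) (suc m ℕ.* suc k) 1 (suc m)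
      (ℕ.≤-reflexive (trans (ℕ.*-comm (suc k) (suc m)) (sym (ℕ.*-identityʳ (suc m ℕ.* suc k)))))
    1≤g : 1ℚ ≤ g
    1≤g = ≤-trans (frac-mono 1 (suc k) 1 1 (ℕ.s≤s ℕ.z≤n)) 1+k≤g
    q<g : q < g
    q<g = ≤-<-trans (≤-numerator q) (<-≤-trans
      (subst₂ _<_ (+-identityˡ (+ k / 1)) (sym (frac-+ 1 k 1)) (+-monoˡ-< (+ k / 1) 0<1)) 1+k≤g)

  P? : ∀ m q j → Dec (grid m j * grid m j ≤ q)
  P? m q j = grid m j * grid m j ≤? q

  limit : ℕ → ℚ → ℕ
  limit m q = suc m ℕ.* suc ℤ.∣ ↥ q ∣

  root-≥0 : ∀ m q → 0ℚ ≤ rootApprox m q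
  root-≥0 m q = frac-≥0 (largest (P? m q) (limit m q)) (suc m)

  root-lower : ∀ m q → rootApprox m q ≡ 0ℚ ⊎ rootApprox m q * rootApprox m q ≤ q
  root-lower m q = map₁
    (λ r≡0 → trans (cong (grid m) r≡0) (≤-antisym (frac-mono 0 0 (suc m) 1 ℕ.z≤n) (frac-≥0 0 (suc m))))
    (largest-sound (P? m q) (limit m q))

  root-upper : ∀ m q → q < (rootApprox m q + grid m 1) * (rootApprox m q + grid m 1)
  root-upper m q = subst (λ z → q < z * z) (trans (cong (grid m) (ℕ.+-comm 1 r)) (frac-+ r 1 (suc m)))
    (≰⇒> (largest-next (P? m q) (limit m q) (λ ()) (λ h → <-irrefl refl (<-≤-trans (limit-large m q) h))))
    where r = largest (P? m q) (limit m q)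

  square-cancel : ∀ {p q} → 0ℚ ≤ q → p * p ≤ q * q → p ≤ q
  square-cancel {p} {q} 0≤q h with p ≤? q
  ... | yes p≤q = p≤q
  ... | no  p≰q = ⊥-elim (<-irrefl refl (<-≤-trans
    (≤-<-trans (*-monoʳ-≤-nonNeg q {{ℚ.nonNegative 0≤q}} (<⇒≤ q<p))
               (*-monoʳ-<-pos p {{ℚ.positive (≤-<-trans 0≤q q<p)}} q<p)) h))
    where q<p = ≰⇒> p≰q

  root-close′ : ∀ {s r g p q η} → s ≡ 0ℚ ⊎ s * s ≤ p → 0ℚ ≤ r → 0ℚ ≤ g → q < (r + g) * (r + g) →
                0ℚ < η → p ≤ q + η * η → g ≤ η → s ≤ r + (η + η)
  root-close′ (inj₁ refl) 0≤r _ _ 0<η _ _ = +-mono-≤ 0≤r (+-mono-≤ (<⇒≤ 0<η) (<⇒≤ 0<η))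
  root-close′ {s} {r} {g} {p} {q} {η} (inj₂ h) 0≤r 0≤g q<u² 0<η p≤q g≤η =
    ≤-trans (square-cancel (+-mono-≤ 0≤u (<⇒≤ 0<η)) (begin
    s * s                               ≤⟨ h ⟩
    p                                   ≤⟨ p≤q ⟩
    q + η * η                           ≤⟨ +-monoˡ-≤ (η * η) (<⇒≤ q<u²) ⟩
    u * u + η * η                       ≤⟨ p≤p+q (0≤* (+-mono-≤ (<⇒≤ 0<1) (<⇒≤ 0<1)) (0≤* 0≤u (<⇒≤ 0<η))) ⟩
    u * u + η * η + (1ℚ + 1ℚ) * (u * η) ≡⟨ solve 2 (λ u η → u :* u :+ η :* η :+ (con 1ℚ :+ con 1ℚ) :* (u :* η) := (u :+ η) :* (u :+ η)) refl u η ⟩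
    (u + η) * (u + η)                   ∎))
    (begin
    u + η                               ≤⟨ +-monoˡ-≤ η (+-monoʳ-≤ r g≤η) ⟩
    r + η + η                           ≡⟨ +-assoc r η η ⟩
    r + (η + η)                         ∎)
    where
    open ≤-Reasoning
    u = r + g
    0≤u : 0ℚ ≤ u
    0≤u = +-mono-≤ 0≤r 0≤g
    p≤p+q : ∀ {a b} → 0ℚ ≤ b → a ≤ a + b
    p≤p+q {a} {b} 0≤b = subst (_≤ a + b) (+-identityʳ a) (+-monoʳ-≤ a 0≤b)

  root-close : ∀ m n p q η → 0ℚ < η → p ≤ q + η * η → grid n 1 ≤ η → rootApprox m p ≤ rootApprox n q + (η + η)
  root-close m n p q η = root-close′ (root-lower m p) (root-≥0 n q) (frac-≥0 1 (suc n)) (root-upper n q)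

open RootLemmas

infix 8 √_

√_ : ℝ → ℝ
(√ x) .seq m = rootApprox m (seq x m)
(√ x) .cauchy ε 0<ε =
  let 0<η = 0<* 0<½ 0<ε
      (N , f) = cauchy x (½ * ε * (½ * ε)) (0<* 0<η 0<η)
      (M , g) = archimedean (½ * ε) 0<η
      l = λ {k} (h : N ℕ.⊔ M ℕ.≤ k) → ℕ.m⊔n≤o⇒m≤o N M h
      r = λ {k} (h : N ℕ.⊔ M ℕ.≤ k) → ℕ.m⊔n≤o⇒n≤o N M h
  in N ℕ.⊔ M , λ m n N≤m N≤n → ≤⇒close
    (half m n (f m n (l N≤m) (l N≤n)) (g n (r N≤n)))
    (half n m (f n m (l N≤n) (l N≤m)) (g m (r N≤m)))
  where
  half : ∀ m n → ∣ seq x m - seq x n ∣ ≤ ½ * ε * (½ * ε) → grid n 1 ≤ ½ * ε →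
         rootApprox m (seq x m) ≤ rootApprox n (seq x n) + ε
  half m n h k = subst (λ z → rootApprox m (seq x m) ≤ rootApprox n (seq x n) + z) (½+½ ε)
    (root-close m n (seq x m) (seq x n) (½ * ε) (0<* 0<½ 0<ε) (close⇒≤ h) k)

invFact : ℕ → ℚ
invFact i = (+ 1 / (i !)) {{i ℕ.!≢0}}

-- Σ_{i ≤ m} 1 / i!
expSum : ℕ → ℚ
expSum zero    = invFact 0
expSum (suc m) = expSum m + invFact (suc m)

module ExpSumLemmas where
  invFact-≥0 : ∀ i → 0ℚ ≤ invFact i
  invFact-≥0 i = frac-≥0 1 (i !) {{i ℕ.!≢0}}

  invFact-halves : ∀ i → 1 ℕ.≤ i → invFact (suc i) + invFact (suc i) ≤ invFact i
  invFact-halves i 1≤i = subst (_≤ invFact i) (frac-+ 1 1 (suc i !) {{suc i ℕ.!≢0}})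
    (frac-mono 2 1 (suc i !) (i !) {{suc i ℕ.!≢0}} {{i ℕ.!≢0}}
      (ℕ.≤-trans (ℕ.*-monoˡ-≤ (i !) (ℕ.s≤s 1≤i)) (ℕ.≤-reflexive (sym (ℕ.*-identityˡ (suc i !))))))

  invFact-small : ∀ i → invFact (suc i) ≤ + 1 / suc i
  invFact-small i = frac-mono 1 1 (suc i !) (suc i) {{suc i ℕ.!≢0}}
    (ℕ.*-monoʳ-≤ 1 (ℕ.m≤m*n (suc i) (i !) {{i ℕ.!≢0}}))

  expSum-mono : ∀ m k → expSum m ≤ expSum (k ℕ.+ m)
  expSum-mono m zero = ≤-refl
  expSum-mono m (suc k) = ≤-trans (expSum-mono m k)
    (subst (_≤ expSum (suc k ℕ.+ m)) (+-identityʳ (expSum (k ℕ.+ m))) (+-monoʳ-≤ (expSum (k ℕ.+ m)) (invFact-≥0 (suc k ℕ.+ m))))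

  expSum-tail : ∀ m k → 1 ℕ.≤ m → expSum (k ℕ.+ m) + invFact (k ℕ.+ m) ≤ expSum m + invFact m
  expSum-tail m zero 1≤m = ≤-refl
  expSum-tail m (suc k) 1≤m = ≤-trans
    (subst (_≤ expSum (k ℕ.+ m) + invFact (k ℕ.+ m)) (sym (+-assoc (expSum (k ℕ.+ m)) (invFact (suc (k ℕ.+ m))) (invFact (suc (k ℕ.+ m)))))
      (+-monoʳ-≤ (expSum (k ℕ.+ m)) (invFact-halves (k ℕ.+ m) (ℕ.≤-trans 1≤m (ℕ.m≤n+m m k)))))
    (expSum-tail m k 1≤m)

  expSum-ordered : ∀ m n → m ℕ.≤ n → expSum m ≤ expSum n
  expSum-ordered m n m≤n = subst (λ z → expSum m ≤ expSum z) (ℕ.m∸n+n≡m m≤n) (expSum-mono m (n ℕ.∸ m))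

  expSum-close : ∀ m n → suc m ℕ.≤ n → expSum n ≤ expSum (suc m) + (+ 1 / suc m)
  expSum-close m n m<n = begin
    expSum n                       ≡⟨ sym (+-identityʳ (expSum n)) ⟩
    expSum n + 0ℚ                  ≤⟨ +-monoʳ-≤ (expSum n) (invFact-≥0 n) ⟩
    expSum n + invFact n              ≤⟨ subst (λ z → expSum z + invFact z ≤ expSum (suc m) + invFact (suc m)) (ℕ.m∸n+n≡m m<n)
                                        (expSum-tail (suc m) (n ℕ.∸ suc m) (ℕ.s≤s ℕ.z≤n)) ⟩
    expSum (suc m) + invFact (suc m)    ≤⟨ +-monoʳ-≤ (expSum (suc m)) (invFact-small m) ⟩
    expSum (suc m) + (+ 1 / suc m) ∎
    where open ≤-Reasoning

open ExpSumLemmas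

𝑒 : ℝ
𝑒 .seq = expSum
𝑒 .cauchy ε 0<ε with archimedean ε 0<ε
... | N , f = suc N , λ m n N<m N<n → ≤⇒close (half m n N<m N<n) (half n m N<n N<m)
  where
  half : ∀ m n → suc N ℕ.≤ m → suc N ℕ.≤ n → expSum m ≤ expSum n + ε
  half m n N<m N<n = ≤-trans (expSum-close N m N<m) (+-mono-≤ (expSum-ordered (suc N) n N<n) (f N ℕ.≤-refl))

instance
  fromℚ-positive : ∀ {q} → .{{ℚ.Positive q}} → Positiveℝ (fromℚ q)
  fromℚ-positive {q} .bound = q
  fromℚ-positive {q} .0<bound = positive⁻¹ q
  fromℚ-positive .from = 0
  fromℚ-positive .bounded _ _ = ≤-refl

  *-positive : ∀ {x y} → {{Positiveℝ x}} → {{Positiveℝ y}} → Positiveℝ (x *ℝ y)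
  *-positive {{x>0}} {{y>0}} .bound = bound x>0 * bound y>0
  *-positive {{x>0}} {{y>0}} .0<bound = 0<* (0<bound x>0) (0<bound y>0)
  *-positive {{x>0}} {{y>0}} .from = from x>0 ℕ.⊔ from y>0
  *-positive {{x>0}} {{y>0}} .bounded m h = *-mono-≤
    (<⇒≤ (0<bound x>0)) (bounded x>0 m (ℕ.m⊔n≤o⇒m≤o (from x>0) (from y>0) h))
    (<⇒≤ (0<bound y>0)) (bounded y>0 m (ℕ.m⊔n≤o⇒n≤o (from x>0) (from y>0) h))

  𝑒-positive : Positiveℝ 𝑒
  𝑒-positive .bound = 1ℚ
  𝑒-positive .0<bound = 0<1
  𝑒-positive .from = 0
  𝑒-positive .bounded m _ = expSum-ordered 0 m ℕ.z≤n

  √3-1-positive : Positiveℝ (√ fromℕ 3 -ℝ fromℕ 1)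
  √3-1-positive .bound = ½
  √3-1-positive .0<bound = 0<½
  √3-1-positive .from = 5
  √3-1-positive .bounded m 5≤m = begin
    ½                                                   ≡⟨⟩
    (+ 5 / 3) + (- (+ 1 / 6) - 1ℚ)                      ≤⟨ +-mono-≤ 5/3≤u (+-monoˡ-≤ (- 1ℚ) (neg-antimono-≤ g≤1/6)) ⟩
    (rootApprox m 3ℚ + grid m 1) + (- grid m 1 - 1ℚ)    ≡⟨ solve 2 (λ r g → (r :+ g) :+ (:- g :- con 1ℚ) := r :- con 1ℚ) refl (rootApprox m 3ℚ) (grid m 1) ⟩
    rootApprox m 3ℚ - 1ℚ                                ∎
    where
    open ≤-Reasoning
    3ℚ = + 3 / 1
    g≤1/6 : grid m 1 ≤ + 1 / 6
    g≤1/6 = frac-mono 1 1 (suc m) 6 (ℕ.*-monoʳ-≤ 1 (ℕ.s≤s 5≤m))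
    5/3≤u : + 5 / 3 ≤ rootApprox m 3ℚ + grid m 1
    5/3≤u = square-cancel (+-mono-≤ (root-≥0 m 3ℚ) (frac-≥0 1 (suc m)))
      (≤-trans (frac-mono 25 3 9 1 (ℕ.m≤m+n 25 2)) (<⇒≤ (root-upper m 3ℚ)))

private variable
  a c s v ℓ : Level

record Graph v ℓ a : Set (lsuc (v ⊔ ℓ ⊔ a)) where
  field
    vertices    : Setoid v ℓ
  open Setoid vertices public using (_≈_) renaming (Carrier to Vertex)
  field
    Adj         : Rel Vertex a
    Adj-sym     : Symmetric Adj
    Adj-irrefl  : ∀ {u w} → u ≈ w → ¬ Adj u w
    Adj-resp-≈  : Adj Respects₂ _≈_

module _ (Γ : Graph v ℓ a) where
  open Graph Γ

  Move : Rel Vertex (ℓ ⊔ a)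
  Move u w = u ≈ w ⊎ Adj u w

  -- A history lists all positions taken by the robber so far, latest first.
  -- `cops h` is the configuration of the cops after they have responded to h;
  -- thus `cops []` is their initial placement. Their own past positions are
  -- determined by the strategy and the robber's positions. Strategies need not
  -- respect _≈_: on a finite vertex setoid one can always normalise the history.
  record CopStrategy (k : ℕ) : Set (v ⊔ ℓ ⊔ a) where
    field
      cops  : List Vertex → Fin k → Vertex
      legal : ∀ r h i → Move (cops h i) (cops (r ∷ h) i)

  -- `robber 0` is the initial placement and `robber (suc t)` the position
  -- after the robber's (t+1)-st turn.
  record RobberPlay : Set (v ⊔ ℓ ⊔ a) where
    field
      robber : ℕ → Vertex
      legal  : ∀ t → Move (robber t) (robber (suc t))

    history : ℕ → List Vertex
    history zero    = []
    history (suc t) = robber t ∷ history t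

  -- While the robber is at `robber t`, the cops are first at
  -- `cops (history t)` and, after their turn, at `cops (history (suc t))`.
  Caught : ∀ {k} → CopStrategy k → RobberPlay → Set ℓ
  Caught σ ρ = ∃[ t ] ∃[ i ] (cops (history t) i ≈ robber t ⊎ cops (history (suc t)) i ≈ robber t)
    where open CopStrategy σ; open RobberPlay ρ

  CopsWin : ℕ → Set (v ⊔ ℓ ⊔ a)
  CopsWin k = ∃[ σ ] (∀ ρ → Caught {k} σ ρ)

  IsCopNumber : ℕ → Set (v ⊔ ℓ ⊔ a)
  IsCopNumber c = CopsWin c × (∀ k → CopsWin k → c ℕ.≤ k)

module _ (G : AbelianGroup c ℓ) where
  open AbelianGroup G renaming (refl to ≈-refl; sym to ≈-sym; trans to ≈-trans)

  data ⟨_⟩ (S : Pred Carrier s) : Pred Carrier (c ⊔ ℓ ⊔ s) where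
    gen  : ∀ {x} → x ∈ S → x ∈ ⟨ S ⟩
    unit : ε ∈ ⟨ S ⟩
    mul  : ∀ {x y} → x ∈ ⟨ S ⟩ → y ∈ ⟨ S ⟩ → x ∙ y ∈ ⟨ S ⟩
    inv  : ∀ {x} → x ∈ ⟨ S ⟩ → x ⁻¹ ∈ ⟨ S ⟩
    resp : ∀ {x y} → x ≈ y → x ∈ ⟨ S ⟩ → y ∈ ⟨ S ⟩

  Negatives : Pred Carrier s → Pred Carrier (c ⊔ ℓ ⊔ s)
  Negatives S x = ∃[ y ] (y ∈ S × x ≈ y ⁻¹)

  record IsConnectionSet (S : Pred Carrier s) : Set (c ⊔ ℓ ⊔ s) where
    field
      respects   : S Respects _≈_
      generating : ∀ x → x ∈ ⟨ S ⟩
      symmetric  : S ≐ Negatives S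
      0∉S        : ε ∉ S

  Cay : (S : Pred Carrier s) → IsConnectionSet S → Graph c ℓ s
  Cay S isC = record
    { vertices   = setoid
    ; Adj        = λ u w → w ∙ u ⁻¹ ∈ S
    ; Adj-sym    = λ {u} {w} h → let (y , y∈S , e) = proj₁ symmetric h in
        respects (≈-trans (≈-sym (⁻¹-involutive y))
          (≈-trans (⁻¹-cong (≈-sym e))
            (≈-trans (⁻¹-anti-homo-∙ w (u ⁻¹)) (∙-congʳ (⁻¹-involutive u))))) y∈S
    ; Adj-irrefl = λ {u} {w} u≈w h → 0∉S (respects (≈-trans (∙-congʳ (≈-sym u≈w)) (inverseʳ u)) h)
    ; Adj-resp-≈ = (λ w≈w′ → respects (∙-congʳ w≈w′)) , (λ u≈u′ → respects (∙-congˡ (⁻¹-cong u≈u′)))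
    }
    where
    open IsConnectionSet isC
    open import Algebra.Properties.Group group using (⁻¹-involutive; ⁻¹-anti-homo-∙)

IsSmallestPrimeFactor : ℕ → ℕ → Set
IsSmallestPrimeFactor p n = Prime p × p ∣ n × (∀ q → Prime q → q ∣ n → p ℕ.≤ q)

{-# OPTIONS --safe #-}
module Submission where

-- Write T = S ∪ {0}, q = |T|, and measure each cop by its difference to the robber. A cop
-- whose difference is a multiple k d (k ≥ 0) of some d ≠ 0 guards every move u ∈ T with
-- u + d ∈ T: it answers u by u + d, which lowers k, and it copies all other moves. To get
-- some cop's difference into ⟨d⟩ one plays the same game in G / ⟨d⟩; so everything is proved
-- relative to a subgroup K, by induction on its index. If m cops suffice modulo K + ⟨d⟩, and
-- m - 1 cops suffice modulo K once the moves guarded by d are forbidden, then m cops suffice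
-- modulo K.
--
-- Let x moves be unguarded modulo K. Averaging over d ∉ K yields a d that multiplies x - 1 by
-- at most 1 - q / n, and d = -(u + v) guards any two moves u and v with u + v ∉ K. Hence
-- t + m + 1 cops win if (q - 1) (1 - q / n)ᵗ ≤ 2 m. Optimising t shows that M + 2 cops win
-- whenever M² e > 2 n, so c ≤ √(2 n / e) + 3; and 2 ≤ 3 / (2 (√3 - 1)) because √3 ≤ 7 / 4.

open import Defs
open import Algebra.Bundles using (AbelianGroup)
open import Algebra.Structures using (IsAbelianGroup)
import Algebra.Properties.AbelianGroup as AbelianGroupProperties
import Algebra.Properties.CommutativeSemigroup as CommutativeSemigroupProperties
import Algebra.Properties.Monoid.Mult as Mult
open import Data.Bool using (if_then_else_)
open import Data.Empty using (⊥; ⊥-elim)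
open import Data.Fin as Fin using (Fin; zero; suc; toℕ; fromℕ<; punchIn)
open import Data.Fin.Permutation using (Permutation; permutation)
import Data.Fin.Properties as Fin
open import Data.Integer as ℤ using (+_)
import Data.Integer.Properties as ℤ
open import Data.List using (List; []; _∷_; length; filter; deduplicate; tabulate)
open import Data.List.Properties using (length-filter; filter-notAll; filter-reject)
open import Data.List.Relation.Unary.All as All using (All; []; _∷_)
import Data.List.Relation.Unary.All.Properties as All
open import Data.List.Relation.Unary.AllPairs using (AllPairs; []; _∷_)
import Data.List.Relation.Unary.AllPairs.Properties as AllPairs
open import Data.List.Relation.Unary.Any as Any using (Any; here; there)
import Data.List.Relation.Unary.Any.Properties as Any
import Data.List.Relation.Unary.Unique.DecSetoid.Properties as Unique
open import Data.Nat as ℕ using (ℕ; zero; suc; pred; _+_; _*_; _∸_; _^_; _!; _≤_; _<_; z≤n; s≤s; NonZero; >-nonZero; _≤?_)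
open import Data.Nat.DivMod using (m/n*n≤m; m≡m%n+[m/n]*n; m%n<n)
open import Data.Nat.Properties as ℕ hiding (_≟_)
open import Data.Nat.Tactic.RingSolver using (solve-∀)
open import Data.Product using (∃-syntax; _×_; _,_; proj₁; proj₂)
open import Data.Rational as ℚ using (ℚ; 0ℚ; 1ℚ; ½; _/_)
import Data.Rational.Properties as ℚ
open import Data.Rational.Solver using (module +-*-Solver)
import Data.Rational.Unnormalised as ℚᵘ
import Data.Rational.Unnormalised.Properties as ℚᵘ
open import Data.Sum using (_⊎_; inj₁; inj₂; [_,_]′)
open import Data.Vec.Functional using (insertAt)
open import Data.Vec.Functional.Properties using (insertAt-lookup; insertAt-punchIn)
open import Effect.Monad using (RawMonad)
open import Function.Base using (_∘_; id)
open import Function.Bundles using (Inverse)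
open import Level using (Level; _⊔_) renaming (suc to lsuc)
open import Relation.Binary using (Rel; Decidable; DecSetoid)
import Relation.Binary.Reasoning.Setoid as SetoidReasoning
open import Relation.Binary.PropositionalEquality using (_≡_; refl; sym; trans; cong; cong₂; subst; subst₂; setoid)
open import Relation.Nullary using (¬_; Dec; yes; no; does; ¬?)
open import Relation.Nullary.Decidable using (map′; _×-dec_; _⊎-dec_; decidable-stable; ¬¬-excluded-middle)
open import Relation.Nullary.Negation using (¬¬-Monad)
open import Relation.Unary using (Pred)
open import Algebra.Properties.Semiring.Sum +-*-semiring using (sum; sum-cong-≗; sum-permute; ∑-distrib-+; *-distribˡ-sum; *-distribʳ-sum)
open RationalLemmas using (frac-mono; frac-+; frac-≥0; 0≤*; 0<1)
open RecipLemmas using (recip-inverse; recip-≥0)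
open RootLemmas using (root-≥0; root-lower; root-upper; square-cancel)
open ExpSumLemmas using (expSum-ordered)
open +-*-Solver using (solve; _:=_; _:+_; _:*_; _:-_; con)

-- Estimates for e

-- The choice of t: with r the integer part of n / q, take t = M - r greedy cops and m = r + 1. It
-- then suffices that q² (1 - q / n)^(M - r) ≤ 2 n. Heuristically the left side is at most e q² exp
-- (- q M / n), since q r ≤ n; this is largest at q = 2 n / M, with value 4 n² / (e M²), which is
-- where the threshold M² e ≥ 2 n comes from. The estimate must hold for every q, because |T| is
-- given. By minimality c - 1 cops do not win, so M = c - 3 cannot exceed the threshold; this gives
-- the 3. The combinatorial side only meets natural numbers: e is replaced by a partial sum
-- `expNumerator j` / `j !`, which is in turn bounded by (w / (w - 1))^w with w = 2 n, so no limit
-- is taken there.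

suc^-bound : ∀ a j → suc a ^ suc j ≤ a ^ suc j + suc j * suc a ^ j
suc^-bound a zero = ≤-reflexive (lemma a)
  where
  lemma : ∀ a → suc a * 1 ≡ a * 1 + 1 * 1
  lemma = solve-∀
suc^-bound a (suc j) = begin
  suc a * b                                  ≡⟨ +-comm b (a * b) ⟩
  a * b + b                                  ≤⟨ +-monoˡ-≤ b (*-monoʳ-≤ a (suc^-bound a j)) ⟩
  a * (a ^ suc j + suc j * suc a ^ j) + b    ≤⟨ m≤m+n _ (suc j * suc a ^ j) ⟩
  a * (a ^ suc j + suc j * suc a ^ j) + b + suc j * suc a ^ j
                                             ≡⟨ lemma a j (a ^ suc j) (suc a ^ j) ⟩
  a ^ suc (suc j) + suc (suc j) * b          ∎
  where
  open ≤-Reasoning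
  b = suc a ^ suc j
  lemma : ∀ a j x y → a * (x + suc j * y) + suc a * y + suc j * y ≡ a * x + suc (suc j) * (suc a * y)
  lemma = solve-∀

-- j! wʲ Σ_{i ≤ j} (a / w)ⁱ / i!
taylor : ℕ → ℕ → ℕ → ℕ
taylor w zero    a = 1
taylor w (suc j) a = suc j * w * taylor w j a + a ^ suc j

-- A mean value estimate: the derivative of `taylor w (suc j)` in its last argument is
-- `suc j * taylor w j`, which is increasing. `suc^-bound` is the same estimate for a single power.
taylor-suc : ∀ w j a → taylor w (suc j) (suc a) ≤ taylor w (suc j) a + suc j * taylor w j (suc a)
taylor-suc w zero a = ≤-reflexive (lemma w a)
  where
  lemma : ∀ w a → 1 * w * 1 + suc a * 1 ≡ 1 * w * 1 + a * 1 + 1 * 1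
  lemma = solve-∀
taylor-suc w (suc j) a = begin
  k * w * taylor w (suc j) (suc a) + suc a ^ k
    ≤⟨ +-mono-≤ (*-monoʳ-≤ (k * w) (taylor-suc w j a)) (suc^-bound a (suc j)) ⟩
  k * w * (taylor w (suc j) a + suc j * taylor w j (suc a)) + (a ^ k + k * suc a ^ suc j)
    ≡⟨ lemma k w (taylor w (suc j) a) (suc j) (taylor w j (suc a)) (a ^ k) (suc a ^ suc j) ⟩
  k * w * taylor w (suc j) a + a ^ k + k * (suc j * w * taylor w j (suc a) + suc a ^ suc j) ∎
  where
  open ≤-Reasoning
  k = suc (suc j)
  lemma : ∀ k w x j y z u → k * w * (x + j * y) + (z + k * u) ≡ k * w * x + z + k * (j * w * y + u)
  lemma = solve-∀

-- exp ((a + 1) / w) (1 - 1 / w) ≤ exp (a / w), for Taylor polynomials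
taylor-ratio : ∀ v j a → v * taylor (suc v) j (suc a) ≤ suc v * taylor (suc v) j a
taylor-ratio v zero a = *-monoˡ-≤ 1 (n≤1+n v)
taylor-ratio v (suc j) a = +-cancelˡ-≤ (taylor w (suc j) (suc a)) _ _ (begin
  w * taylor w (suc j) (suc a)                                  ≤⟨ *-monoʳ-≤ w (taylor-suc w j a) ⟩
  w * (taylor w (suc j) a + suc j * taylor w j (suc a))         ≡⟨ lemma w (taylor w (suc j) a) (suc j) (taylor w j (suc a)) ⟩
  suc j * w * taylor w j (suc a) + w * taylor w (suc j) a       ≤⟨ +-monoˡ-≤ (w * taylor w (suc j) a) (m≤m+n (suc j * w * taylor w j (suc a)) (suc a ^ suc j)) ⟩
  taylor w (suc j) (suc a) + w * taylor w (suc j) a             ∎)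
  where
  open ≤-Reasoning
  w = suc v
  lemma : ∀ w x j y → w * (x + j * y) ≡ j * w * y + w * x
  lemma = solve-∀

taylor-power : ∀ v j a → v ^ a * taylor (suc v) j a ≤ suc v ^ a * taylor (suc v) j 0
taylor-power v j zero = ≤-refl
taylor-power v j (suc a) = begin
  v * v ^ a * taylor w j (suc a)     ≡⟨ lemma v (v ^ a) (taylor w j (suc a)) ⟩
  v ^ a * (v * taylor w j (suc a))   ≤⟨ *-monoʳ-≤ (v ^ a) (taylor-ratio v j a) ⟩
  v ^ a * (w * taylor w j a)         ≡⟨ lemma w (v ^ a) (taylor w j a) ⟨
  w * v ^ a * taylor w j a           ≡⟨ *-assoc w (v ^ a) (taylor w j a) ⟩
  w * (v ^ a * taylor w j a)         ≤⟨ *-monoʳ-≤ w (taylor-power v j a) ⟩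
  w * (w ^ a * taylor w j 0)         ≡⟨ *-assoc w (w ^ a) (taylor w j 0) ⟨
  w * w ^ a * taylor w j 0           ∎
  where
  open ≤-Reasoning
  w = suc v
  lemma : ∀ v x y → v * x * y ≡ x * (v * y)
  lemma = solve-∀

-- j! Σ_{i ≤ j} 1 / i!
expNumerator : ℕ → ℕ
expNumerator zero    = 1
expNumerator (suc j) = suc j * expNumerator j + 1

taylor-at-w : ∀ w j → taylor w j w ≡ w ^ j * expNumerator j
taylor-at-w w zero = refl
taylor-at-w w (suc j) rewrite taylor-at-w w j = lemma (suc j) w (w ^ j) (expNumerator j)
  where
  lemma : ∀ k w x y → k * w * (x * y) + w * x ≡ w * x * (k * y + 1)
  lemma = solve-∀

taylor-at-0 : ∀ w j → taylor w j 0 ≡ w ^ j * j !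
taylor-at-0 w zero = refl
taylor-at-0 w (suc j) rewrite taylor-at-0 w j = lemma (suc j) w (w ^ j) (j !)
  where
  lemma : ∀ k w x y → k * w * (x * y) + 0 ≡ w * x * (k * y)
  lemma = solve-∀

-- e ≤ (w / (w - 1))ʷ
expNumerator-bound : ∀ v j → v ^ suc v * expNumerator j ≤ suc v ^ suc v * j !
expNumerator-bound v j = *-cancelˡ-≤ (w ^ j) {{m^n≢0 w j}} (begin
  w ^ j * (v ^ w * expNumerator j)   ≡⟨ lemma (w ^ j) (v ^ w) (expNumerator j) ⟩
  v ^ w * (w ^ j * expNumerator j)   ≡⟨ cong (v ^ w *_) (taylor-at-w w j) ⟨
  v ^ w * taylor w j w               ≤⟨ taylor-power v j w ⟩
  w ^ w * taylor w j 0               ≡⟨ cong (w ^ w *_) (taylor-at-0 w j) ⟩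
  w ^ w * (w ^ j * j !)              ≡⟨ lemma (w ^ j) (w ^ w) (j !) ⟨
  w ^ j * (w ^ w * j !)              ∎)
  where
  open ≤-Reasoning
  w = suc v
  lemma : ∀ x y z → x * (y * z) ≡ y * (x * z)
  lemma = solve-∀

bernoulli-+ : ∀ v k → (suc v + k) * v ^ k ≤ suc v * suc v ^ k
bernoulli-+ v zero = ≤-reflexive (cong (_* 1) (+-identityʳ (suc v)))
bernoulli-+ v (suc k) = begin
  (w + suc k) * (v * v ^ k)        ≤⟨ m≤m+n _ (suc k * v ^ k) ⟩
  (w + suc k) * (v * v ^ k) + suc k * v ^ k
                                   ≡⟨ lemma v k (v ^ k) ⟩
  w * ((w + k) * v ^ k)            ≤⟨ *-monoʳ-≤ w (bernoulli-+ v k) ⟩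
  w * (w * w ^ k)                  ∎
  where
  open ≤-Reasoning
  w = suc v
  lemma : ∀ v k x → (suc v + suc k) * (v * x) + suc k * x ≡ suc v * ((suc v + k) * x)
  lemma = solve-∀

-- Bernoulli's inequality 1 - k / w ≤ (1 - 1 / w)^k for w = `suc v`, with c = w - k given by an
-- equation to avoid truncated subtraction.
bernoulli-∸ : ∀ v k c → c + k ≡ suc v → c * suc v ^ k ≤ suc v * v ^ k
bernoulli-∸ v zero c e = ≤-reflexive (cong (_* 1) (trans (sym (+-identityʳ c)) e))
bernoulli-∸ v (suc k) c e = begin
  c * (w * w ^ k)          ≡⟨ lemma₁ c w (w ^ k) ⟩
  c * w * w ^ k            ≤⟨ *-monoˡ-≤ (w ^ k) cw≤ ⟩
  v * suc c * w ^ k        ≡⟨ *-assoc v (suc c) (w ^ k) ⟩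
  v * (suc c * w ^ k)      ≤⟨ *-monoʳ-≤ v (bernoulli-∸ v k (suc c) (trans (sym (+-suc c k)) e)) ⟩
  v * (w * v ^ k)          ≡⟨ lemma₂ v w (v ^ k) ⟩
  w * (v * v ^ k)          ∎
  where
  open ≤-Reasoning
  w = suc v
  c≤v : c ≤ v
  c≤v = subst (c ≤_) (suc-injective (trans (sym (+-suc c k)) e)) (m≤m+n c k)
  cw≤ : c * w ≤ v * suc c
  cw≤ = begin
    c * suc v    ≡⟨ *-suc c v ⟩
    c + c * v    ≤⟨ +-monoˡ-≤ (c * v) c≤v ⟩
    v + c * v    ≡⟨ cong (λ z → v + z) (*-comm c v) ⟩
    v + v * c    ≡⟨ *-suc v c ⟨
    v * suc c    ∎
  lemma₁ : ∀ c w x → c * (w * x) ≡ c * w * x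
  lemma₁ = solve-∀
  lemma₂ : ∀ v w x → v * (w * x) ≡ w * (v * x)
  lemma₂ = solve-∀

-- exp x ≥ 1 + x at x = b / w - 1, of either sign
bernoulli : ∀ v b → b * v ^ b * suc v ^ suc v ≤ suc v * suc v ^ b * v ^ suc v
bernoulli v b with ≤-total (suc v) b
... | inj₁ w≤b = begin
  b * v ^ b * w ^ w                 ≡⟨ cong₂ (λ x y → x * y * w ^ w) (sym (m+[n∸m]≡n w≤b)) (split v) ⟩
  (w + k) * (v ^ w * v ^ k) * w ^ w ≡⟨ lemma₁ (w + k) (v ^ w) (v ^ k) (w ^ w) ⟩
  (w + k) * v ^ k * (w ^ w * v ^ w) ≤⟨ *-monoˡ-≤ (w ^ w * v ^ w) (bernoulli-+ v k) ⟩
  w * w ^ k * (w ^ w * v ^ w)       ≡⟨ lemma₂ w (w ^ k) (w ^ w) (v ^ w) ⟩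
  w * (w ^ w * w ^ k) * v ^ w       ≡⟨ cong (λ y → w * y * v ^ w) (split w) ⟨
  w * w ^ b * v ^ w                 ∎
  where
  open ≤-Reasoning
  w = suc v
  k = b ∸ w
  split : ∀ x → x ^ b ≡ x ^ w * x ^ k
  split x = trans (cong (x ^_) (sym (m+[n∸m]≡n w≤b))) (^-distribˡ-+-* x w k)
  lemma₁ : ∀ a x y z → a * (x * y) * z ≡ a * y * (z * x)
  lemma₁ = solve-∀
  lemma₂ : ∀ w x y z → w * x * (y * z) ≡ w * (y * x) * z
  lemma₂ = solve-∀
... | inj₂ b≤w = begin
  b * v ^ b * w ^ w                 ≡⟨ cong (b * v ^ b *_) (split w) ⟩
  b * v ^ b * (w ^ b * w ^ k)       ≡⟨ lemma₁ b (v ^ b) (w ^ b) (w ^ k) ⟩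
  b * w ^ k * (v ^ b * w ^ b)       ≤⟨ *-monoˡ-≤ (v ^ b * w ^ b) (bernoulli-∸ v k b (m+[n∸m]≡n b≤w)) ⟩
  w * v ^ k * (v ^ b * w ^ b)       ≡⟨ lemma₂ w (v ^ k) (v ^ b) (w ^ b) ⟩
  w * w ^ b * (v ^ b * v ^ k)       ≡⟨ cong (w * w ^ b *_) (split v) ⟨
  w * w ^ b * v ^ w                 ∎
  where
  open ≤-Reasoning
  w = suc v
  k = w ∸ b
  split : ∀ x → x ^ w ≡ x ^ b * x ^ k
  split x = trans (cong (x ^_) (sym (m+[n∸m]≡n b≤w))) (^-distribˡ-+-* x b k)
  lemma₁ : ∀ a x y z → a * x * (y * z) ≡ a * z * (x * y)
  lemma₁ = solve-∀
  lemma₂ : ∀ w x y z → w * x * (y * z) ≡ w * z * (y * x)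
  lemma₂ = solve-∀

^-*-distrib : ∀ a b k → (a * b) ^ k ≡ a ^ k * b ^ k
^-*-distrib a b zero = refl
^-*-distrib a b (suc k) rewrite ^-*-distrib a b k = lemma a b (a ^ k) (b ^ k)
  where
  lemma : ∀ a b x y → a * b * (x * y) ≡ a * x * (b * y)
  lemma = solve-∀

-- With r ≤ n / q and e ≥ 2 n / M², this is q² (1 - q / n)^(M - r) ≤ 2 n:
-- by `bernoulli`, (w / v)^(2 q M - w) ≥ e (q M / w)² ≥ q² / w.
decay : ∀ n v q M r t → .{{NonZero v}} → suc v ≡ 2 * n → q ≤ n → q * r ≤ n → t + r ≡ M →
        let w = suc v in
        w * v ^ w ≤ M * M * w ^ w →
        q * q * (n ∸ q) ^ t ≤ w * n ^ t
decay n v q M r t e q≤n qr≤n refl H = *-cancelʳ-≤ _ _ (w ^ (2 * q * t)) {{m^n≢0 w (2 * q * t)}} (begin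
  q * q * (n ∸ q) ^ t * w ^ (2 * q * t)       ≡⟨ *-assoc (q * q) _ _ ⟩
  q * q * ((n ∸ q) ^ t * w ^ (2 * q * t))     ≤⟨ *-monoʳ-≤ (q * q) step₁ ⟩
  q * q * (n ^ t * v ^ (2 * q * t))           ≡⟨ lemma₁ (q * q) (n ^ t) (v ^ (2 * q * t)) ⟩
  n ^ t * (q * q * v ^ (2 * q * t))           ≤⟨ *-monoʳ-≤ (n ^ t) step₄ ⟩
  n ^ t * (w * w ^ (2 * q * t))               ≡⟨ lemma₂ w (n ^ t) (w ^ (2 * q * t)) ⟩
  w * n ^ t * w ^ (2 * q * t)                 ∎)
  where
  open ≤-Reasoning
  w = suc v
  b = q * M
  lemma₁ : ∀ a x y → a * (x * y) ≡ x * (a * y)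
  lemma₁ = solve-∀
  lemma₂ : ∀ w x y → x * (w * y) ≡ w * x * y
  lemma₂ = solve-∀

  -- With w = 2 n, 1 - q / n is 1 - 2 q / w, to which Bernoulli applies.
  step₀ : (n ∸ q) * w ^ (2 * q) ≤ n * v ^ (2 * q)
  step₀ = *-cancelˡ-≤ 2 (begin
    2 * ((n ∸ q) * w ^ (2 * q))  ≡⟨ *-assoc 2 (n ∸ q) _ ⟨
    2 * (n ∸ q) * w ^ (2 * q)    ≤⟨ bernoulli-∸ v (2 * q) (2 * (n ∸ q))
                                      (trans (sym (*-distribˡ-+ 2 (n ∸ q) q)) (trans (cong (2 *_) (m∸n+n≡m q≤n)) (sym e))) ⟩
    w * v ^ (2 * q)              ≡⟨ cong (_* v ^ (2 * q)) e ⟩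
    2 * n * v ^ (2 * q)          ≡⟨ *-assoc 2 n _ ⟩
    2 * (n * v ^ (2 * q))        ∎)

  step₁ : (n ∸ q) ^ t * w ^ (2 * q * t) ≤ n ^ t * v ^ (2 * q * t)
  step₁ = subst₂ _≤_ (unfold (n ∸ q) w) (unfold n v) (^-monoˡ-≤ t step₀)
    where
    unfold : ∀ x y → (x * y ^ (2 * q)) ^ t ≡ x ^ t * y ^ (2 * q * t)
    unfold x y = trans (^-*-distrib x (y ^ (2 * q)) t) (cong (x ^ t *_) (^-*-assoc y (2 * q) t))

  -- The square of `bernoulli` at b = q M, combined with `H`. Bernoulli is exact at q M = w, the
  -- critical size q = 2 n / M.
  step₂ : q * q * v ^ b * v ^ b * w ^ w ≤ w * w ^ b * w ^ b * v ^ w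
  step₂ = *-cancelʳ-≤ _ _ (w * v ^ w) {{m*n≢0 w (v ^ w) {{_}} {{m^n≢0 v w}}}} (begin
    q * q * v ^ b * v ^ b * w ^ w * (w * v ^ w)          ≤⟨ *-monoʳ-≤ (q * q * v ^ b * v ^ b * w ^ w) H ⟩
    q * q * v ^ b * v ^ b * w ^ w * (M * M * w ^ w)      ≡⟨ lemma₃ q M (v ^ b) (w ^ w) ⟩
    b * v ^ b * w ^ w * (b * v ^ b * w ^ w)              ≤⟨ *-mono-≤ (bernoulli v b) (bernoulli v b) ⟩
    w * w ^ b * v ^ w * (w * w ^ b * v ^ w)              ≡⟨ lemma₄ w (w ^ b) (v ^ w) ⟩
    w * w ^ b * w ^ b * v ^ w * (w * v ^ w)              ∎)
    where
    lemma₃ : ∀ q M x y → q * q * x * x * y * (M * M * y) ≡ q * M * x * y * (q * M * x * y)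
    lemma₃ = solve-∀
    lemma₄ : ∀ w x y → w * x * y * (w * x * y) ≡ w * x * x * y * (w * y)
    lemma₄ = solve-∀

  -- Using t = M - r instead of M costs at most the factor (w / v)^w, which approximates e, because
  -- 2 q r ≤ 2 n = w.
  step₃ : w ^ (2 * q * r) * v ^ w ≤ v ^ (2 * q * r) * w ^ w
  step₃ = begin
    w ^ k * v ^ w             ≡⟨ cong (w ^ k *_) (split v) ⟩
    w ^ k * (v ^ k * v ^ z)   ≡⟨ lemma₁ (w ^ k) (v ^ k) (v ^ z) ⟩
    v ^ k * (w ^ k * v ^ z)   ≤⟨ *-monoʳ-≤ (v ^ k) (*-monoʳ-≤ (w ^ k) (^-monoˡ-≤ z (n≤1+n v))) ⟩
    v ^ k * (w ^ k * w ^ z)   ≡⟨ cong (v ^ k *_) (split w) ⟨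
    v ^ k * w ^ w             ∎
    where
    k = 2 * q * r
    k≤w : k ≤ w
    k≤w = ≤-trans (≤-reflexive (*-assoc 2 q r)) (≤-trans (*-monoʳ-≤ 2 qr≤n) (≤-reflexive (sym e)))
    z = w ∸ k
    split : ∀ x → x ^ w ≡ x ^ k * x ^ z
    split x = trans (cong (x ^_) (sym (m+[n∸m]≡n k≤w))) (^-distribˡ-+-* x k z)

  step₄ : q * q * v ^ (2 * q * t) ≤ w * w ^ (2 * q * t)
  step₄ = *-cancelʳ-≤ _ _ (v ^ k * w ^ w) {{m*n≢0 (v ^ k) (w ^ w) {{m^n≢0 v k}} {{m^n≢0 w w}}}} (begin
    q * q * v ^ (2 * q * t) * (v ^ k * w ^ w)   ≡⟨ lemma₅ (q * q) (v ^ (2 * q * t)) (v ^ k) (w ^ w) ⟩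
    q * q * (v ^ (2 * q * t) * v ^ k) * w ^ w   ≡⟨ cong (λ x → q * q * x * w ^ w) (merge v) ⟩
    q * q * (v ^ b * v ^ b) * w ^ w             ≡⟨ cong (_* w ^ w) (*-assoc (q * q) (v ^ b) (v ^ b)) ⟨
    q * q * v ^ b * v ^ b * w ^ w               ≤⟨ step₂ ⟩
    w * w ^ b * w ^ b * v ^ w                   ≡⟨ cong (_* v ^ w) (*-assoc w (w ^ b) (w ^ b)) ⟩
    w * (w ^ b * w ^ b) * v ^ w                 ≡⟨ cong (λ x → w * x * v ^ w) (merge w) ⟨
    w * (w ^ (2 * q * t) * w ^ k) * v ^ w       ≡⟨ lemma₅ w (w ^ (2 * q * t)) (w ^ k) (v ^ w) ⟨
    w * w ^ (2 * q * t) * (w ^ k * v ^ w)       ≤⟨ *-monoʳ-≤ (w * w ^ (2 * q * t)) step₃ ⟩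
    w * w ^ (2 * q * t) * (v ^ k * w ^ w)       ∎)
    where
    k = 2 * q * r
    lemma₅ : ∀ a x y z → a * x * (y * z) ≡ a * (x * y) * z
    lemma₅ = solve-∀
    lemma₆ : ∀ q t r → 2 * q * t + 2 * q * r ≡ q * (t + r) + q * (t + r)
    lemma₆ = solve-∀
    merge : ∀ x → x ^ (2 * q * t) * x ^ k ≡ x ^ b * x ^ b
    merge x = trans (sym (^-distribˡ-+-* x (2 * q * t) k))
      (trans (cong (x ^_) (lemma₆ q t r)) (^-distribˡ-+-* x b b))

-- t greedy cops, each multiplying the number of unguarded moves (less one) by 1 - q / n,
-- and then m + 1 cops guarding two moves each
split-cops : ∀ n q M j → .{{NonZero n}} → .{{NonZero q}} → q ≤ n → 2 * n * j ! ≤ M * M * expNumerator j →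
             ∃[ m ] ∃[ t ] (suc (m + t) ≡ M + 2 × pred q * (n ∸ q) ^ t ≤ 2 * m * n ^ t)
split-cops n@(suc n′) q M j q≤n large with r ≤? M
  where r = n ℕ./ q
-- Here q (M + 1) ≤ n ≤ 2 M², so T is small enough to be guarded in pairs alone.
... | no r≰M = suc M , 0 , trans (cong suc (+-identityʳ (suc M))) (+-comm 2 M) , *-monoˡ-≤ 1 (begin
  pred q      ≤⟨ pred[n]≤n ⟩
  q           ≤⟨ *-cancelʳ-≤ q (2 * M) (suc M) (begin
    q * suc M           ≤⟨ *-monoʳ-≤ q (≰⇒> r≰M) ⟩
    q * r               ≡⟨ *-comm q r ⟩
    r * q               ≤⟨ m/n*n≤m n q ⟩
    n                   ≤⟨ n≤2M² ⟩
    2 * (M * M)         ≡⟨ *-assoc 2 M M ⟨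
    2 * M * M           ≤⟨ *-monoʳ-≤ (2 * M) (n≤1+n M) ⟩
    2 * M * suc M       ∎) ⟩
  2 * M       ≤⟨ *-monoʳ-≤ 2 (n≤1+n M) ⟩
  2 * suc M   ∎)
  where
  open ≤-Reasoning
  r = n ℕ./ q
  lemma : ∀ n x → 2 * (n * x) ≡ 2 * n * x
  lemma = solve-∀
  lemma′ : ∀ M x → M * M * (4 * x) ≡ 2 * (2 * (M * M) * x)
  lemma′ = solve-∀
  -- e ≤ 4
  n≤2M² : n ≤ 2 * (M * M)
  n≤2M² = *-cancelʳ-≤ n (2 * (M * M)) (j !) {{j !≢0}} (*-cancelˡ-≤ 2 (begin
    2 * (n * j !)              ≡⟨ lemma n (j !) ⟩
    2 * n * j !                ≤⟨ large ⟩
    M * M * expNumerator j     ≤⟨ *-monoʳ-≤ (M * M) (≤-trans (m≤m+n _ 0) (expNumerator-bound 1 j)) ⟩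
    M * M * (4 * j !)          ≡⟨ lemma′ M (j !) ⟩
    2 * (2 * (M * M) * j !)    ∎))
-- As n ≤ (r + 1) q, one factor q cancels from the bound of `decay` and leaves 2 (r + 1), that is 2
-- m.
... | yes r≤M = suc r , t , trans (cong (λ x → suc (suc x)) (m+[n∸m]≡n r≤M)) (+-comm 2 M) , (begin
  pred q * (n ∸ q) ^ t       ≤⟨ *-monoˡ-≤ ((n ∸ q) ^ t) (pred[n]≤n {q}) ⟩
  q * (n ∸ q) ^ t            ≤⟨ *-cancelˡ-≤ q (begin
    q * (q * (n ∸ q) ^ t)       ≡⟨ *-assoc q q ((n ∸ q) ^ t) ⟨
    q * q * (n ∸ q) ^ t         ≤⟨ decay n v q M r t {{v≢0}} refl q≤n (≤-trans (≤-reflexive (*-comm q r)) (m/n*n≤m n q)) (m∸n+n≡m r≤M) H ⟩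
    2 * n * n ^ t               ≤⟨ *-monoˡ-≤ (n ^ t) (*-monoʳ-≤ 2 n≤) ⟩
    2 * (suc r * q) * n ^ t     ≡⟨ lemma (suc r) q (n ^ t) ⟩
    q * (2 * suc r * n ^ t)     ∎) ⟩
  2 * suc r * n ^ t          ∎)
  where
  open ≤-Reasoning
  r = n ℕ./ q
  t = M ∸ r
  w = 2 * n
  v = pred w
  v≢0 : NonZero v
  v≢0 = >-nonZero (≤-trans (s≤s z≤n) (m≤n+m (suc (n′ + 0)) n′))
  lemma : ∀ r q x → 2 * (r * q) * x ≡ q * (2 * r * x)
  lemma = solve-∀
  lemma₁ : ∀ w x j → w * x * j ≡ x * (w * j)
  lemma₁ = solve-∀
  lemma₂ : ∀ w x j → w * (x * j) ≡ x * (w * j)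
  lemma₂ = solve-∀
  n≤ : n ≤ suc r * q
  n≤ = begin
    n                 ≡⟨ m≡m%n+[m/n]*n n q ⟩
    n ℕ.% q + r * q   ≤⟨ +-monoˡ-≤ (r * q) (<⇒≤ (m%n<n n q)) ⟩
    q + r * q         ∎
  H : w * v ^ w ≤ M * M * w ^ w
  H = *-cancelʳ-≤ _ _ (j !) {{j !≢0}} (begin
    w * v ^ w * j !                   ≡⟨ lemma₁ w (v ^ w) (j !) ⟩
    v ^ w * (w * j !)                 ≤⟨ *-monoʳ-≤ (v ^ w) large ⟩
    v ^ w * (M * M * expNumerator j)  ≡⟨ lemma₂ (v ^ w) (M * M) (expNumerator j) ⟩
    M * M * (v ^ w * expNumerator j)  ≤⟨ *-monoʳ-≤ (M * M) (expNumerator-bound v j) ⟩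
    M * M * (w ^ w * j !)             ≡⟨ *-assoc (M * M) (w ^ w) (j !) ⟨
    M * M * w ^ w * j !               ∎)

-- The bounds as inequalities between rational approximations

frac-cong : ∀ i j m n .{{_ : ℕ.NonZero m}} .{{_ : ℕ.NonZero n}} → i ℕ.* n ≡ j ℕ.* m → + i / m ≡ + j / n
frac-cong i j m n e = ℚ.≤-antisym (frac-mono i j m n (ℕ.≤-reflexive e)) (frac-mono j i n m (ℕ.≤-reflexive (sym e)))

frac-* : ∀ i j m n .{{_ : ℕ.NonZero m}} .{{_ : ℕ.NonZero n}} →
         (+ i / m) ℚ.* (+ j / n) ≡ (+ (i ℕ.* j) / (m ℕ.* n)) {{ℕ.m*n≢0 m n}}
frac-* i j (suc m) (suc n) = ℚ.toℚᵘ-injective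
  (ℚᵘ.≃-trans (ℚ.toℚᵘ-homo-* (+ i / suc m) (+ j / suc n))
  (ℚᵘ.≃-trans (ℚᵘ.*-cong (ℚ.toℚᵘ-fromℚᵘ (ℚᵘ.mkℚᵘ (+ i) m)) (ℚ.toℚᵘ-fromℚᵘ (ℚᵘ.mkℚᵘ (+ j) n)))
  (ℚᵘ.≃-trans (ℚᵘ.*≡* (cong (ℤ._* (+ suc m ℤ.* + suc n)) (sym (ℤ.pos-* i j))))
    (ℚᵘ.≃-sym (ℚ.toℚᵘ-fromℚᵘ (ℚᵘ.mkℚᵘ (+ (i ℕ.* j)) (n ℕ.+ m ℕ.* suc n)))))))

expSum-fraction : ∀ j → expSum j ≡ (+ expNumerator j / (j !)) {{j ℕ.!≢0}}
expSum-fraction zero = refl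
expSum-fraction (suc j) = trans
  (cong (ℚ._+ invFact (suc j)) (trans (expSum-fraction j)
    (frac-cong (expNumerator j) (suc j ℕ.* expNumerator j) (j !) (suc j !) {{j ℕ.!≢0}} {{suc j ℕ.!≢0}}
      (lemma (expNumerator j) (suc j) (j !)))))
  (sym (frac-+ (suc j ℕ.* expNumerator j) 1 (suc j !) {{suc j ℕ.!≢0}}))
  where
  lemma : ∀ x k y → x ℕ.* (k ℕ.* y) ≡ k ℕ.* x ℕ.* y
  lemma = solve-∀

1≤expSum : ∀ m → 1ℚ ℚ.≤ expSum m
1≤expSum m = expSum-ordered 0 m ℕ.z≤n

-- E stands for a partial sum of e and cancels: M² E ≤ 2 n ≤ Q E n. The two parts of the theorem
-- differ only in the radicand Q, and 2 ≤ Q E is all that this needs from it; u and v are upper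
-- approximations of the roots of Q and n.
geometric-bound : ∀ {M n Q E u v} → 0ℚ ℚ.≤ n → 0ℚ ℚ.≤ Q → 0ℚ ℚ.≤ u → 0ℚ ℚ.≤ v → 0ℚ ℚ.< E →
  M ℚ.* M ℚ.* E ℚ.≤ (+ 2 / 1) ℚ.* n → + 2 / 1 ℚ.≤ Q ℚ.* E → Q ℚ.≤ u ℚ.* u → n ℚ.≤ v ℚ.* v → M ℚ.≤ u ℚ.* v
geometric-bound {M} {n} {Q} {E} {u} {v} 0≤n 0≤Q 0≤u 0≤v 0<E M²E≤2n 2≤QE Q≤u² n≤v² = square-cancel (0≤* 0≤u 0≤v) (begin
  M ℚ.* M                      ≤⟨ M²≤Qn ⟩
  Q ℚ.* n                      ≤⟨ RationalLemmas.*-mono-≤ 0≤Q Q≤u² 0≤n n≤v² ⟩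
  u ℚ.* u ℚ.* (v ℚ.* v)        ≡⟨ solve 2 (λ u v → u :* u :* (v :* v) := u :* v :* (u :* v)) refl u v ⟩
  u ℚ.* v ℚ.* (u ℚ.* v)        ∎)
  where
  open ℚ.≤-Reasoning
  M²≤Qn : M ℚ.* M ℚ.≤ Q ℚ.* n
  M²≤Qn = ℚ.*-cancelʳ-≤-pos E {{ℚ.positive 0<E}} (begin
    M ℚ.* M ℚ.* E         ≤⟨ M²E≤2n ⟩
    (+ 2 / 1) ℚ.* n       ≤⟨ ℚ.*-monoʳ-≤-nonNeg n {{ℚ.nonNegative 0≤n}} 2≤QE ⟩
    Q ℚ.* E ℚ.* n         ≡⟨ solve 3 (λ q y e → q :* y :* e := q :* e :* y) refl Q E n ⟩
    Q ℚ.* n ℚ.* E         ∎)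

module Quotient {A Y E : ℚ} (0≤A : 0ℚ ℚ.≤ A) (1≤Y : 1ℚ ℚ.≤ Y) where
  open ℚ.≤-Reasoning
  private
    0<Y : 0ℚ ℚ.< Y
    0<Y = ℚ.<-≤-trans 0<1 1≤Y
    QY≡A : A ℚ.* recip Y ℚ.* Y ≡ A
    QY≡A = trans (ℚ.*-assoc A (recip Y) Y) (trans (cong (A ℚ.*_) (recip-inverse Y 0<Y)) (ℚ.*-identityʳ A))

  quotient-≥0 : 0ℚ ℚ.≤ A ℚ.* recip Y
  quotient-≥0 = 0≤* 0≤A (recip-≥0 Y 0<Y)

  quotient-≤ : A ℚ.* recip Y ℚ.≤ A
  quotient-≤ = begin
    Q             ≡⟨ ℚ.*-identityʳ Q ⟨
    Q ℚ.* 1ℚ      ≤⟨ ℚ.*-monoˡ-≤-nonNeg Q {{ℚ.nonNegative quotient-≥0}} 1≤Y ⟩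
    Q ℚ.* Y       ≡⟨ QY≡A ⟩
    A             ∎
    where
    Q = A ℚ.* recip Y

  quotient-lower : ∀ {b} → b ℚ.* Y ℚ.≤ A ℚ.* E → b ℚ.≤ A ℚ.* recip Y ℚ.* E
  quotient-lower {b} bY≤AE = ℚ.*-cancelʳ-≤-pos Y {{ℚ.positive 0<Y}} (begin
    b ℚ.* Y             ≤⟨ bY≤AE ⟩
    A ℚ.* E             ≡⟨ cong (ℚ._* E) QY≡A ⟨
    Q ℚ.* Y ℚ.* E       ≡⟨ solve 3 (λ q y e → q :* y :* e := q :* e :* y) refl Q Y E ⟩
    Q ℚ.* E ℚ.* Y       ∎)
    where
    Q = A ℚ.* recip Y

root-≤′ : ∀ {r q b} → r ≡ 0ℚ ⊎ r ℚ.* r ℚ.≤ q → 0ℚ ℚ.≤ b → q ℚ.≤ b ℚ.* b → r ℚ.≤ b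
root-≤′ (inj₁ refl) 0≤b _    = 0≤b
root-≤′ (inj₂ r²≤q) 0≤b q≤b² = square-cancel 0≤b (ℚ.≤-trans r²≤q q≤b²)

root-≤ : ∀ m q b → 0ℚ ℚ.≤ b → q ℚ.≤ b ℚ.* b → rootApprox m q ℚ.≤ b
root-≤ m q b = root-≤′ {rootApprox m q} {q} {b} (root-lower m q)

fromℕ-≤-square : ∀ n → + n / 1 ℚ.≤ (+ n / 1) ℚ.* (+ n / 1)
fromℕ-≤-square n = subst (+ n / 1 ℚ.≤_) (sym (frac-* n n 1 1)) (frac-mono n (n ℕ.* n) 1 1 (ℕ.*-monoˡ-≤ 1 (lemma n)))
  where
  lemma : ∀ n → n ≤ n ℕ.* n
  lemma zero    = ℕ.z≤n
  lemma (suc n) = ℕ.m≤m*n (suc n) (suc n)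

-- The left side is (p + g) (q + g) - p q for g = `grid m 1`, the error of multiplying the rounded
-- roots. In n + 3, the 2 bounds p, the n bounds q, and the last 1 bounds g.
grid-error : ∀ m n {p q} → 2 ℕ.* (n ℕ.+ 3) ≤ m → p ℚ.≤ + 2 / 1 → q ℚ.≤ + n / 1 →
             grid m 1 ℚ.* (p ℚ.+ q ℚ.+ grid m 1) ℚ.≤ ½
grid-error m n {p} {q} m-large p≤2 q≤n = begin
  g ℚ.* (p ℚ.+ q ℚ.+ g)        ≤⟨ ℚ.*-monoˡ-≤-nonNeg g {{ℚ.nonNegative (frac-≥0 1 (suc m))}} sum≤k ⟩
  g ℚ.* (+ k / 1)              ≡⟨ frac-* 1 k (suc m) 1 ⟩
  + (1 ℕ.* k) / (suc m ℕ.* 1)  ≤⟨ frac-mono (1 ℕ.* k) 1 (suc m ℕ.* 1) 2 k≤ ⟩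
  ½                            ∎
  where
  open ℚ.≤-Reasoning
  g : ℚ
  g = grid m 1
  k : ℕ
  k = n ℕ.+ 3
  sum≤k : p ℚ.+ q ℚ.+ g ℚ.≤ + k / 1
  sum≤k = begin
    p ℚ.+ q ℚ.+ g
      ≤⟨ ℚ.+-mono-≤ (ℚ.+-mono-≤ p≤2 q≤n) (frac-mono 1 1 (suc m) 1 (ℕ.s≤s ℕ.z≤n)) ⟩
    (+ 2 / 1) ℚ.+ (+ n / 1) ℚ.+ 1ℚ
      ≡⟨ solve 1 (λ n → con (+ 2 / 1) :+ n :+ con 1ℚ := n :+ con (+ 3 / 1)) refl (+ n / 1) ⟩
    (+ n / 1) ℚ.+ (+ 3 / 1)          ≡⟨ frac-+ n 3 1 ⟨
    + k / 1                          ∎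
  lemma : ∀ k → 1 ℕ.* k ℕ.* 2 ≡ 2 ℕ.* k
  lemma = solve-∀
  lemma′ : ∀ k → k ≡ 1 ℕ.* (k ℕ.* 1)
  lemma′ = solve-∀
  k≤ : 1 ℕ.* k ℕ.* 2 ≤ 1 ℕ.* (suc m ℕ.* 1)
  k≤ = ℕ.≤-trans (ℕ.≤-reflexive (lemma k))
    (ℕ.≤-trans m-large (ℕ.≤-trans (ℕ.n≤1+n m) (ℕ.≤-reflexive (lemma′ (suc m)))))

expSum-bound : ∀ M n m → M ℕ.* M ℕ.* expNumerator m ≤ 2 ℕ.* n ℕ.* m ! →
               (+ M / 1) ℚ.* (+ M / 1) ℚ.* expSum m ℚ.≤ (+ 2 / 1) ℚ.* (+ n / 1)
expSum-bound M n m small = begin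
  (+ M / 1) ℚ.* (+ M / 1) ℚ.* expSum m
    ≡⟨ cong₂ ℚ._*_ (frac-* M M 1 1) (expSum-fraction m) ⟩
  (+ (M ℕ.* M) / 1) ℚ.* (+ expNumerator m / (m !))
    ≡⟨ frac-* (M ℕ.* M) (expNumerator m) 1 (m !) ⟩
  + (M ℕ.* M ℕ.* expNumerator m) / (1 ℕ.* m !)
    ≤⟨ frac-mono (M ℕ.* M ℕ.* expNumerator m) (2 ℕ.* n) (1 ℕ.* m !) 1
         (ℕ.≤-trans (ℕ.≤-reflexive (ℕ.*-identityʳ _))
           (ℕ.≤-trans small (ℕ.*-monoʳ-≤ (2 ℕ.* n) (ℕ.≤-reflexive (sym (ℕ.*-identityˡ (m !))))))) ⟩
  + (2 ℕ.* n) / 1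
    ≡⟨ frac-* 2 n 1 1 ⟨
  (+ 2 / 1) ℚ.* (+ n / 1) ∎
  where
  open ℚ.≤-Reasoning
  instance
    m!≢0 : ℕ.NonZero (m !)
    m!≢0 = m ℕ.!≢0
    1*m!≢0 : ℕ.NonZero (1 ℕ.* m !)
    1*m!≢0 = ℕ.m*n≢0 1 (m !)

absorb-error : ∀ {M p q g ε} → M ℚ.≤ (p ℚ.+ g) ℚ.* (q ℚ.+ g) → g ℚ.* (p ℚ.+ q ℚ.+ g) ℚ.≤ ½ → 0ℚ ℚ.< ε →
               M ℚ.+ (+ 3 / 1) ℚ.≤ p ℚ.* q ℚ.+ (+ 7 / 2) ℚ.+ ε
absorb-error {M} {p} {q} {g} {ε} M≤ error≤½ 0<ε = begin
  M ℚ.+ (+ 3 / 1)                              ≤⟨ ℚ.+-monoˡ-≤ (+ 3 / 1) M≤ ⟩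
  (p ℚ.+ g) ℚ.* (q ℚ.+ g) ℚ.+ (+ 3 / 1)        ≡⟨ cong (ℚ._+ (+ 3 / 1)) (solve 3 (λ p q g → (p :+ g) :* (q :+ g) := p :* q :+ g :* (p :+ q :+ g)) refl p q g) ⟩
  p ℚ.* q ℚ.+ g ℚ.* (p ℚ.+ q ℚ.+ g) ℚ.+ (+ 3 / 1)
                                               ≤⟨ ℚ.+-monoˡ-≤ (+ 3 / 1) (ℚ.+-monoʳ-≤ (p ℚ.* q) error≤½) ⟩
  p ℚ.* q ℚ.+ ½ ℚ.+ (+ 3 / 1)                  ≡⟨ ℚ.+-assoc (p ℚ.* q) ½ (+ 3 / 1) ⟩
  p ℚ.* q ℚ.+ (+ 7 / 2)                        ≡⟨ ℚ.+-identityʳ _ ⟨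
  p ℚ.* q ℚ.+ (+ 7 / 2) ℚ.+ 0ℚ                 ≤⟨ ℚ.+-monoʳ-≤ (p ℚ.* q ℚ.+ (+ 7 / 2)) (ℚ.<⇒≤ 0<ε) ⟩
  p ℚ.* q ℚ.+ (+ 7 / 2) ℚ.+ ε                  ∎
  where open ℚ.≤-Reasoning

0≤+ : ∀ {p q} → 0ℚ ℚ.≤ p → 0ℚ ℚ.≤ q → 0ℚ ℚ.≤ p ℚ.+ q
0≤+ 0≤p 0≤q = ℚ.+-mono-≤ 0≤p 0≤q

√-product-approx : ∀ M n m {Q ε} → 0ℚ ℚ.≤ Q → Q ℚ.≤ + 4 / 1 → + 2 / 1 ℚ.≤ Q ℚ.* expSum m →
  M ℕ.* M ℕ.* expNumerator m ≤ 2 ℕ.* n ℕ.* m ! → 2 ℕ.* (n ℕ.+ 3) ≤ m → 0ℚ ℚ.< ε →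
  (+ M / 1) ℚ.+ (+ 3 / 1) ℚ.≤ rootApprox m Q ℚ.* rootApprox m (+ n / 1) ℚ.+ (+ 7 / 2) ℚ.+ ε
√-product-approx M n m {Q} {ε} 0≤Q Q≤4 2≤QE small m-large 0<ε =
  absorb-error {+ M / 1} {rootApprox m Q} {rootApprox m (+ n / 1)} {grid m 1} {ε} M≤uv error≤½ 0<ε
  where
  0≤u : 0ℚ ℚ.≤ rootApprox m Q ℚ.+ grid m 1
  0≤u = 0≤+ {rootApprox m Q} {grid m 1} (root-≥0 m Q) (frac-≥0 1 (suc m))
  0≤v : 0ℚ ℚ.≤ rootApprox m (+ n / 1) ℚ.+ grid m 1
  0≤v = 0≤+ {rootApprox m (+ n / 1)} {grid m 1} (root-≥0 m (+ n / 1)) (frac-≥0 1 (suc m))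
  M≤uv : + M / 1 ℚ.≤ (rootApprox m Q ℚ.+ grid m 1) ℚ.* (rootApprox m (+ n / 1) ℚ.+ grid m 1)
  M≤uv = geometric-bound {+ M / 1} {+ n / 1} {Q} {expSum m} {rootApprox m Q ℚ.+ grid m 1} {rootApprox m (+ n / 1) ℚ.+ grid m 1}
    (frac-≥0 n 1) 0≤Q 0≤u 0≤v
    (ℚ.<-≤-trans 0<1 (1≤expSum m)) (expSum-bound M n m small) 2≤QE
    (ℚ.<⇒≤ (root-upper m Q)) (ℚ.<⇒≤ (root-upper m (+ n / 1)))
  error≤½ : grid m 1 ℚ.* (rootApprox m Q ℚ.+ rootApprox m (+ n / 1) ℚ.+ grid m 1) ℚ.≤ ½
  error≤½ = grid-error m n {rootApprox m Q} {rootApprox m (+ n / 1)} m-large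
    (root-≤ m Q (+ 2 / 1) (frac-≥0 2 1) Q≤4) (root-≤ m (+ n / 1) (+ n / 1) (frac-≥0 n 1) (fromℕ-≤-square n))

-- Stated for variable reals, with their terms given by equations, so that checking it unfolds no
-- concrete sequence.
seq-√*√+ : ∀ x y z m {p q r} → seq x m ≡ p → seq y m ≡ q → seq z m ≡ r →
           seq (√ x *ℝ √ y +ℝ z) m ≡ rootApprox m p ℚ.* rootApprox m q ℚ.+ r
seq-√*√+ x y z m refl refl refl = refl

≤ℝ-intro : ∀ {c w} {k v : ℕ → ℚ} → (∀ m → seq c m ≡ k m) → (∀ m → seq w m ≡ v m) →
  (∀ ε → 0ℚ ℚ.< ε → ∃[ N ] (∀ m → N ≤ m → k m ℚ.≤ v m ℚ.+ ε)) → c ≤ℝ w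
≤ℝ-intro c≡k w≡v h ε 0<ε = let (N , h′) = h ε 0<ε in
  N , λ m N≤m → subst₂ (λ p q → p ℚ.≤ q ℚ.+ ε) (sym (c≡k m)) (sym (w≡v m)) (h′ m N≤m)

-- The approximations of the roots are too small by at most 1 / (m + 1), which is
-- absorbed by replacing 3 with 7 / 2.
√-product-bound : ∀ M n k c x y z → k ≤ M ℕ.+ 3 → (∀ m → seq c m ≡ + k / 1) → (∀ m → seq y m ≡ + n / 1) → (∀ m → seq z m ≡ + 7 / 2) →
  (∀ j → M ℕ.* M ℕ.* expNumerator j ≤ 2 ℕ.* n ℕ.* j !) →
  ∃[ N ] (∀ m → N ≤ m → 0ℚ ℚ.≤ seq x m × seq x m ℚ.≤ + 4 / 1 × + 2 / 1 ℚ.≤ seq x m ℚ.* expSum m) →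
  c ≤ℝ √ x *ℝ √ y +ℝ z
√-product-bound M n k c x y z k≤ c≡ y≡ z≡ small (N , hyp) = ≤ℝ-intro {c} {√ x *ℝ √ y +ℝ z}
  {λ m → + k / 1} {λ m → rootApprox m (seq x m) ℚ.* rootApprox m (+ n / 1) ℚ.+ (+ 7 / 2)}
  c≡
  (λ m → seq-√*√+ x y z m {seq x m} {+ n / 1} {+ 7 / 2} refl (y≡ m) (z≡ m))
  λ ε 0<ε → N ℕ.⊔ 2 ℕ.* (n ℕ.+ 3) , λ m h →
    let (0≤x , x≤4 , 2≤xE) = hyp m (ℕ.m⊔n≤o⇒m≤o N _ h)
    in ℚ.≤-trans k≤M+3 (√-product-approx M n m {seq x m} {ε} 0≤x x≤4 2≤xE (small m) (ℕ.m⊔n≤o⇒n≤o N _ h) 0<ε)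
  where
  k≤M+3 : + k / 1 ℚ.≤ (+ M / 1) ℚ.+ (+ 3 / 1)
  k≤M+3 = ℚ.≤-trans (frac-mono k (M ℕ.+ 3) 1 1 (ℕ.*-monoˡ-≤ 1 k≤)) (ℚ.≤-reflexive (frac-+ M 3 1))

÷-bounds : ∀ a x y (y>0 : Positiveℝ y) m → seq x m ≡ + a / 1 → a ≤ 4 →
  1ℚ ℚ.≤ seq y m → (+ 2 / 1) ℚ.* seq y m ℚ.≤ (+ a / 1) ℚ.* expSum m →
  0ℚ ℚ.≤ seq ((x ÷ℝ y) {{y>0}}) m × seq ((x ÷ℝ y) {{y>0}}) m ℚ.≤ + 4 / 1 ×
  + 2 / 1 ℚ.≤ seq ((x ÷ℝ y) {{y>0}}) m ℚ.* expSum m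
÷-bounds a x y y>0 m x≡a a≤4 1≤y 2y≤aE = quotient-≥0 , ℚ.≤-trans quotient-≤ x≤4 ,
  quotient-lower {+ 2 / 1} (subst (λ z → (+ 2 / 1) ℚ.* seq y m ℚ.≤ z ℚ.* expSum m) (sym x≡a) 2y≤aE)
  where
  open Quotient {seq x m} {seq y m} {expSum m} (subst (0ℚ ℚ.≤_) (sym x≡a) (frac-≥0 a 1)) 1≤y
  x≤4 : seq x m ℚ.≤ + 4 / 1
  x≤4 = subst (ℚ._≤ + 4 / 1) (sym x≡a) (frac-mono a 4 1 1 (ℕ.*-monoˡ-≤ 1 a≤4))

√[2/e]-bound : ∀ M n k → k ≤ M ℕ.+ 3 → (∀ j → M ℕ.* M ℕ.* expNumerator j ≤ 2 ℕ.* n ℕ.* j !) →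
         fromℕ k ≤ℝ √ (fromℕ 2 ÷ℝ 𝑒) *ℝ √ fromℕ n +ℝ fromℚ (+ 7 / 2)
√[2/e]-bound M n k k≤ small = √-product-bound M n k (fromℕ k) ((fromℕ 2 ÷ℝ 𝑒) {{𝑒-positive}}) (fromℕ n) (fromℚ (+ 7 / 2))
  k≤ (λ _ → refl) (λ _ → refl) (λ _ → refl) small
  (0 , λ m _ → ÷-bounds 2 (fromℕ 2) 𝑒 𝑒-positive m refl (ℕ.s≤s (ℕ.s≤s ℕ.z≤n)) (1≤expSum m) ℚ.≤-refl)

seq-*-√- : ∀ x y z w m → seq (x *ℝ (√ y -ℝ z) *ℝ w) m ≡ seq x m ℚ.* (rootApprox m (seq y m) ℚ.- seq z m) ℚ.* seq w m
seq-*-√- x y z w m = refl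

seq-2[√3-1]e : ∀ x y z w m {r e} → seq x m ≡ + 2 / 1 → seq y m ≡ + 3 / 1 → seq z m ≡ 1ℚ → seq w m ≡ e → rootApprox m (+ 3 / 1) ≡ r →
  seq (x *ℝ (√ y -ℝ z) *ℝ w) m ≡ (+ 2 / 1) ℚ.* (r ℚ.- 1ℚ) ℚ.* e
seq-2[√3-1]e x y z w m {r} x≡2 y≡3 z≡1 refl √3≡r = trans (seq-*-√- x y z w m)
  (cong₂ (λ p q → p ℚ.* q ℚ.* seq w m) x≡2 (cong₂ ℚ._-_ (trans (cong (rootApprox m) y≡3) √3≡r) z≡1))

-- 7 / 4 is the solution of 4 (r - 1) = 3. At r = √3 the inequality is 2 ≤ 3 / (2 (√3 - 1)), in the
-- denominator-free form that `÷-bounds` expects.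
4[r-1]e≤3e : ∀ {r e} → r ℚ.≤ + 7 / 4 → 0ℚ ℚ.≤ e → (+ 2 / 1) ℚ.* ((+ 2 / 1) ℚ.* (r ℚ.- 1ℚ) ℚ.* e) ℚ.≤ (+ 3 / 1) ℚ.* e
4[r-1]e≤3e {r} {e} r≤7/4 0≤e = begin
  (+ 2 / 1) ℚ.* ((+ 2 / 1) ℚ.* (r ℚ.- 1ℚ) ℚ.* e)
    ≡⟨ solve 2 (λ r e → con (+ 2 / 1) :* (con (+ 2 / 1) :* (r :- con 1ℚ) :* e) := (con (+ 4 / 1) :* (r :- con 1ℚ)) :* e) refl r e ⟩
  (+ 4 / 1) ℚ.* (r ℚ.- 1ℚ) ℚ.* e
    ≤⟨ ℚ.*-monoʳ-≤-nonNeg e {{ℚ.nonNegative 0≤e}} (ℚ.*-monoˡ-≤-nonNeg (+ 4 / 1) (ℚ.+-monoˡ-≤ (ℚ.- 1ℚ) r≤7/4)) ⟩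
  (+ 3 / 1) ℚ.* e ∎
  where open ℚ.≤-Reasoning

2[√3-1]e : ℝ
2[√3-1]e = fromℕ 2 *ℝ (√ fromℕ 3 -ℝ fromℕ 1) *ℝ 𝑒

2[√3-1]e-positive : Positiveℝ 2[√3-1]e
2[√3-1]e-positive = *-positive {fromℕ 2 *ℝ (√ fromℕ 3 -ℝ fromℕ 1)} {𝑒} {{*-positive {fromℕ 2} {√ fromℕ 3 -ℝ fromℕ 1}}}

-- The positivity proof already carries the lower bound 2 · ½ · 1 from index 5 on.
1≤2[√3-1]e : ∀ m → 5 ≤ m → 1ℚ ℚ.≤ seq 2[√3-1]e m
1≤2[√3-1]e m 5≤m = Positiveℝ.bounded 2[√3-1]e-positive m 5≤m

4[√3-1]e≤3e : ∀ m → (+ 2 / 1) ℚ.* seq 2[√3-1]e m ℚ.≤ (+ 3 / 1) ℚ.* expSum m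
4[√3-1]e≤3e m = subst (λ z → (+ 2 / 1) ℚ.* z ℚ.≤ (+ 3 / 1) ℚ.* expSum m)
  {(+ 2 / 1) ℚ.* (ρ ℚ.- 1ℚ) ℚ.* expSum m} {seq 2[√3-1]e m}
  (sym (seq-2[√3-1]e (fromℕ 2) (fromℕ 3) (fromℕ 1) 𝑒 m {ρ} {expSum m} refl refl refl refl refl))
  (4[r-1]e≤3e {ρ} {expSum m} (root-≤ m (+ 3 / 1) (+ 7 / 4) (frac-≥0 7 4) (frac-mono 3 49 1 16 (ℕ.m≤m+n 48 1)))
    (ℚ.≤-trans (ℚ.<⇒≤ 0<1) (1≤expSum m)))
  where
  ρ : ℚ
  ρ = rootApprox m (+ 3 / 1)

√[3/2[√3-1]e]-bound′ : ∀ M n k → k ≤ M ℕ.+ 3 → (∀ j → M ℕ.* M ℕ.* expNumerator j ≤ 2 ℕ.* n ℕ.* j !) →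
          fromℕ k ≤ℝ √ ((fromℕ 3 ÷ℝ 2[√3-1]e) {{2[√3-1]e-positive}}) *ℝ √ fromℕ n +ℝ fromℚ (+ 7 / 2)
√[3/2[√3-1]e]-bound′ M n k k≤ small = √-product-bound M n k (fromℕ k) ((fromℕ 3 ÷ℝ 2[√3-1]e) {{2[√3-1]e-positive}}) (fromℕ n) (fromℚ (+ 7 / 2))
  k≤ (λ _ → refl) (λ _ → refl) (λ _ → refl) small
  (5 , λ m 5≤m → ÷-bounds 3 (fromℕ 3) 2[√3-1]e 2[√3-1]e-positive m refl (ℕ.s≤s (ℕ.s≤s (ℕ.s≤s ℕ.z≤n)))
    (1≤2[√3-1]e m 5≤m) (4[√3-1]e≤3e m))

-- Comparing the two inequalities instead of the two reals would unfold _≤ℝ_ and normalise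
-- the rational approximations.
√[3/2[√3-1]e]-unfold : ∀ n → (√ ((fromℕ 3 ÷ℝ 2[√3-1]e) {{2[√3-1]e-positive}}) *ℝ √ fromℕ n +ℝ fromℚ (+ 7 / 2)) ≡
                      (√ (fromℕ 3 ÷ℝ (fromℕ 2 *ℝ (√ fromℕ 3 -ℝ fromℕ 1) *ℝ 𝑒)) *ℝ √ fromℕ n +ℝ fromℚ (+ 7 / 2))
√[3/2[√3-1]e]-unfold n = refl

√[3/2[√3-1]e]-bound : ∀ M n k → k ≤ M ℕ.+ 3 → (∀ j → M ℕ.* M ℕ.* expNumerator j ≤ 2 ℕ.* n ℕ.* j !) →
         fromℕ k ≤ℝ √ (fromℕ 3 ÷ℝ (fromℕ 2 *ℝ (√ fromℕ 3 -ℝ fromℕ 1) *ℝ 𝑒)) *ℝ √ fromℕ n +ℝ fromℚ (+ 7 / 2)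
√[3/2[√3-1]e]-bound M n k k≤ small = subst (λ z → fromℕ k ≤ℝ z) (√[3/2[√3-1]e]-unfold n) (√[3/2[√3-1]e]-bound′ M n k k≤ small)

-- Counting

private variable
  a b : Level

𝟙 : {P : Set a} → Dec P → ℕ
𝟙 P? = if does P? then 1 else 0

𝟙-mono : {P : Set a} {Q : Set b} (P? : Dec P) (Q? : Dec Q) → (P → Q) → 𝟙 P? ≤ 𝟙 Q?
𝟙-mono (no _)  _       _ = z≤n
𝟙-mono (yes p) (yes q) _ = ≤-refl
𝟙-mono (yes p) (no ¬q) f = ⊥-elim (¬q (f p))

𝟙-cong : {P : Set a} {Q : Set b} (P? : Dec P) (Q? : Dec Q) → (P → Q) → (Q → P) → 𝟙 P? ≡ 𝟙 Q?
𝟙-cong P? Q? f g = ≤-antisym (𝟙-mono P? Q? f) (𝟙-mono Q? P? g)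

𝟙-yes : {P : Set a} (P? : Dec P) → P → 1 ≤ 𝟙 P?
𝟙-yes (yes _) _ = ≤-refl
𝟙-yes (no ¬p) p = ⊥-elim (¬p p)

𝟙-¬ : {P : Set a} (P? : Dec P) → 𝟙 P? + 𝟙 (¬? P?) ≡ 1
𝟙-¬ (yes _) = refl
𝟙-¬ (no _)  = refl

sum-mono-≤ : ∀ {n} {f g : Fin n → ℕ} → (∀ i → f i ≤ g i) → sum f ≤ sum g
sum-mono-≤ {zero}  f≤g = z≤n
sum-mono-≤ {suc n} f≤g = +-mono-≤ (f≤g zero) (sum-mono-≤ (f≤g ∘ suc))

sum-mono-< : ∀ {n} {f g : Fin n → ℕ} → (∀ i → f i ≤ g i) → ∀ i → f i < g i → sum f < sum g
sum-mono-< f≤g zero    f<g = +-mono-<-≤ f<g (sum-mono-≤ (f≤g ∘ suc))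
sum-mono-< f≤g (suc i) f<g = +-mono-≤-< (f≤g zero) (sum-mono-< (f≤g ∘ suc) i f<g)

sum-1 : ∀ n → sum {n} (λ _ → 1) ≡ n
sum-1 zero    = refl
sum-1 (suc n) = cong suc (sum-1 n)

module _ {A : Set a} {P : Pred A b} (P? : ∀ x → Dec (P x)) where
  count : List A → ℕ
  count []      = 0
  count (x ∷ l) = 𝟙 (P? x) + count l

  count-≤-length : ∀ l → count l ≤ length l
  count-≤-length []      = z≤n
  count-≤-length (x ∷ l) with P? x
  ... | yes _ = s≤s (count-≤-length l)
  ... | no  _ = m≤n⇒m≤1+n (count-≤-length l)

  count-none : ∀ {l} → All (λ x → ¬ P x) l → count l ≡ 0
  count-none []        = refl
  count-none {x ∷ l} (¬p ∷ ¬ps) with P? x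
  ... | yes p = ⊥-elim (¬p p)
  ... | no  _ = count-none ¬ps

  filter-count : ∀ l → length (filter (¬? ∘ P?) l) + count l ≡ length l
  filter-count [] = refl
  filter-count (x ∷ l) with P? x
  ... | yes _ = trans (+-suc _ _) (cong suc (filter-count l))
  ... | no  _ = cong suc (filter-count l)

-- x and k are the numbers of unguarded moves and of elements of K, and τ = |T + K|. If every
-- d outside K guarded fewer than q (x - 1) / n moves, then averaging would give `few`.
averaging : ∀ n k j y q τ → k + j ≡ n → 1 ≤ j → suc y * k ≤ τ → q ≤ τ →
            ¬ (n * (suc y * τ) + j ≤ k * (n * suc y) + j * (q * y))
averaging n k j y q τ refl 1≤j xk≤τ q≤τ few = n≮n _ (begin-strict
  k * (n * suc y) + j * (q * y)     ≡⟨ lemma₁ k n y (j * (q * y)) ⟩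
  n * (suc y * k) + j * (q * y)     ≤⟨ +-mono-≤ (*-monoʳ-≤ n xk≤τ) (*-monoʳ-≤ j (*-monoˡ-≤ y q≤τ)) ⟩
  n * τ + j * (τ * y)               ≤⟨ m≤m+n _ (k * (τ * y)) ⟩
  n * τ + j * (τ * y) + k * (τ * y) ≡⟨ lemma₂ k j y τ ⟩
  n * (suc y * τ)                   <⟨ m<m+n (n * (suc y * τ)) 1≤j ⟩
  n * (suc y * τ) + j               ≤⟨ few ⟩
  k * (n * suc y) + j * (q * y)     ∎)
  where
  open ≤-Reasoning
  lemma₁ : ∀ k n y z → k * (n * suc y) + z ≡ n * (suc y * k) + z
  lemma₁ = solve-∀
  lemma₂ : ∀ k j y τ → (k + j) * τ + j * (τ * y) + k * (τ * y) ≡ (k + j) * (suc y * τ)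
  lemma₂ = solve-∀

-- Subgroups as congruences, and adjoining an element

module _ {c ℓ} (G : AbelianGroup c ℓ) where
  open AbelianGroup G using (Carrier; _≈_; _∙_; ε; _⁻¹; monoid; isAbelianGroup)
  private
    module G = AbelianGroup G
  open Mult monoid using (×-homo-+; ×-assocˡ; ×-congʳ; ×-congˡ) renaming (_×_ to _·_)

  ·-ε : ∀ k → k · ε ≈ ε
  ·-ε zero    = G.refl
  ·-ε (suc k) = G.trans (G.identityˡ _) (·-ε k)

  -- The congruences of G stand for its subgroups: the subgroup of ~ is { x ∣ x ~ ε }.
  record Congruence : Set (c ⊔ lsuc ℓ) where
    infix 4 _~_ _~?_
    field
      _~_              : Rel Carrier ℓ
      ~-isAbelianGroup : IsAbelianGroup _~_ _∙_ ε _⁻¹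
      ≈⇒~              : ∀ {x y} → x ≈ y → x ~ y
      _~?_             : Decidable _~_

    -- Passing to the quotient keeps the carrier and changes only the equality, so positions and
    -- moves need no translation.
    quotient : AbelianGroup c ℓ
    quotient = record { isAbelianGroup = ~-isAbelianGroup }

    open AbelianGroup quotient public
      using () renaming
      ( refl to ~-refl; sym to ~-sym; trans to ~-trans; ∙-cong to ~-∙-cong; ∙-congˡ to ~-∙-congˡ
      ; ∙-congʳ to ~-∙-congʳ; ⁻¹-cong to ~-⁻¹-cong; setoid to ~-setoid)
    open AbelianGroupProperties quotient public
      using () renaming (∙-cancelˡ to ~-cancelˡ; ∙-cancelʳ to ~-cancelʳ; ⁻¹-injective to ~-⁻¹-injective; ε⁻¹≈ε to ~-ε⁻¹)

    x~zy⇒xy⁻¹~z : ∀ {x y z} → x ~ z ∙ y → x ∙ y ⁻¹ ~ z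
    x~zy⇒xy⁻¹~z {x} {y} {z} x~zy = ~-trans (~-∙-congʳ x~zy) (≈⇒~ (begin
      z ∙ y ∙ y ⁻¹    ≈⟨ G.assoc z y (y ⁻¹) ⟩
      z ∙ (y ∙ y ⁻¹)  ≈⟨ G.∙-congˡ (G.inverseʳ y) ⟩
      z ∙ ε           ≈⟨ G.identityʳ z ⟩
      z               ∎))
      where open SetoidReasoning G.setoid

  -- Generation expressed by the subgroups containing T rather than by a closure; `guard-one`
  -- applies it to the current subgroup.
  Generates : ∀ {s} → Pred Carrier s → Set (c ⊔ lsuc ℓ ⊔ s)
  Generates T = (κ : Congruence) → let open Congruence κ in (∀ {t} → T t → t ~ ε) → ∀ x → x ~ ε

  module _ (κ : Congruence) (d : Carrier) (o : ℕ) (od≈ε : suc o · d ≈ ε) where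
    open Congruence κ
    private
      open SetoidReasoning ~-setoid
      open CommutativeSemigroupProperties (AbelianGroup.commutativeSemigroup quotient) using (interchange)

      infix 4 _≋_
      -- Natural multiples suffice because d has finite order: - k d = (k o) d. The natural number k
      -- later counts the guarded moves still needed to catch the robber.
      _≋_ : Rel Carrier ℓ
      x ≋ y = ∃[ k ] x ~ y ∙ k · d

      multiples : ∀ k → (k * suc o) · d ≈ ε
      multiples k = G.trans (G.sym (×-assocˡ d k (suc o))) (G.trans (×-congʳ k od≈ε) (·-ε k))

      k+ko : ∀ k → k · d ∙ (k * o) · d ≈ ε
      k+ko k = G.trans (G.sym (×-homo-+ d k (k * o))) (G.trans (×-congˡ (sym (*-suc k o))) (multiples k))

      ~⇒≋ : ∀ {x y} → x ~ y → x ≋ y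
      ~⇒≋ x~y = 0 , ~-trans x~y (~-sym (≈⇒~ (G.identityʳ _)))

      ≋-sym : ∀ {x y} → x ≋ y → y ≋ x
      ≋-sym {x} {y} (k , e) = k * o , ~-sym (begin
        x ∙ (k * o) · d               ≈⟨ ~-∙-congʳ e ⟩
        y ∙ k · d ∙ (k * o) · d       ≈⟨ ≈⇒~ (G.assoc y (k · d) ((k * o) · d)) ⟩
        y ∙ (k · d ∙ (k * o) · d)     ≈⟨ ≈⇒~ (G.∙-congˡ (k+ko k)) ⟩
        y ∙ ε                         ≈⟨ ≈⇒~ (G.identityʳ y) ⟩
        y                             ∎)

      ≋-trans : ∀ {x y z} → x ≋ y → y ≋ z → x ≋ z
      ≋-trans {x} {y} {z} (k , e) (l , f) = l + k , (begin
        x                       ≈⟨ e ⟩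
        y ∙ k · d               ≈⟨ ~-∙-congʳ f ⟩
        z ∙ l · d ∙ k · d       ≈⟨ ≈⇒~ (G.assoc z (l · d) (k · d)) ⟩
        z ∙ (l · d ∙ k · d)     ≈⟨ ≈⇒~ (G.∙-congˡ (×-homo-+ d l k)) ⟨
        z ∙ (l + k) · d         ∎)

      ≋-∙-cong : ∀ {x y z w} → x ≋ y → z ≋ w → x ∙ z ≋ y ∙ w
      ≋-∙-cong {x} {y} {z} {w} (k , e) (l , f) = k + l , (begin
        x ∙ z                         ≈⟨ ~-∙-cong e f ⟩
        y ∙ k · d ∙ (w ∙ l · d)       ≈⟨ interchange y (k · d) w (l · d) ⟩
        y ∙ w ∙ (k · d ∙ l · d)       ≈⟨ ≈⇒~ (G.∙-congˡ (×-homo-+ d k l)) ⟨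
        y ∙ w ∙ (k + l) · d           ∎)

      ≋-⁻¹-cong : ∀ {x y} → x ≋ y → x ⁻¹ ≋ y ⁻¹
      ≋-⁻¹-cong {x} {y} (k , e) = k * o , (begin
        x ⁻¹                      ≈⟨ ~-⁻¹-cong e ⟩
        (y ∙ k · d) ⁻¹            ≈⟨ ≈⇒~ (⁻¹-∙-comm y (k · d)) ⟨
        y ⁻¹ ∙ (k · d) ⁻¹         ≈⟨ ≈⇒~ (G.∙-congˡ (inverseʳ-unique (k · d) ((k * o) · d) (k+ko k))) ⟨
        y ⁻¹ ∙ (k * o) · d        ∎)
        where open AbelianGroupProperties G using (⁻¹-∙-comm; inverseʳ-unique)

      ≋? : Decidable _≋_
      ≋? x y = map′ (λ (i , e) → toℕ i , e) reduce (Fin.any? λ (i : Fin (suc o)) → x ~? y ∙ toℕ i · d)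
        where
        reduce : x ≋ y → ∃[ i ] x ~ y ∙ toℕ {suc o} i · d
        reduce (k , e) = fromℕ< k%o<o , ~-trans e (≈⇒~ (G.∙-congˡ (
          G.trans (×-congˡ (m≡m%n+[m/n]*n k (suc o)))
          (G.trans (×-homo-+ d (k ℕ.% suc o) (k ℕ./ suc o * suc o))
          (G.trans (G.∙-congˡ (multiples (k ℕ./ suc o)))
          (G.trans (G.identityʳ _) (×-congˡ (sym (Fin.toℕ-fromℕ< k%o<o)))))))))
          where
          k%o<o : k ℕ.% suc o < suc o
          k%o<o = m%n<n k (suc o)

    adjoin : Congruence
    adjoin = record
      { _~_ = _≋_
      ; ~-isAbelianGroup = record
        { isGroup = record
          { isMonoid = record
            { isSemigroup = record
              { isMagma = record
                { isEquivalence = record { refl = ~⇒≋ ~-refl ; sym = ≋-sym ; trans = ≋-trans }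
                ; ∙-cong = ≋-∙-cong }
              ; assoc = λ x y z → ~⇒≋ (Q.assoc x y z) }
            ; identity = (λ x → ~⇒≋ (Q.identityˡ x)) , (λ x → ~⇒≋ (Q.identityʳ x)) }
          ; inverse = (λ x → ~⇒≋ (Q.inverseˡ x)) , (λ x → ~⇒≋ (Q.inverseʳ x))
          ; ⁻¹-cong = ≋-⁻¹-cong }
        ; comm = λ x y → ~⇒≋ (Q.comm x y) }
      ; ≈⇒~ = λ x≈y → ~⇒≋ (≈⇒~ x≈y)
      ; _~?_ = ≋? }
      where module Q = AbelianGroup quotient

    ~⇒adjoin : ∀ {x y} → x ~ y → Congruence._~_ adjoin x y
    ~⇒adjoin = ~⇒≋

    adjoin-d : Congruence._~_ adjoin d ε
    adjoin-d = 1 , ~-sym (≈⇒~ (G.trans (G.identityˡ _) (G.identityʳ d)))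

-- The pursuit game modulo a subgroup

module Pursuit {c ℓ s} (G : AbelianGroup c ℓ) (n : ℕ) (enum : Inverse (AbelianGroup.setoid G) (setoid (Fin n)))
  (T : Pred (AbelianGroup.Carrier G) s) (T? : ∀ x → Dec (T x))
  (T-resp : ∀ {x y} → AbelianGroup._≈_ G x y → T x → T y)
  (T-ε : T (AbelianGroup.ε G)) (T-⁻¹ : ∀ {x} → T x → T (AbelianGroup._⁻¹ G x))
  (T-generates : Generates G T) where
  open AbelianGroup G using (Carrier; _≈_; _∙_; ε; _⁻¹; monoid)
  private
    module G = AbelianGroup G
  open Inverse enum using (to; from; to-cong; strictlyInverseˡ; strictlyInverseʳ)
  open Mult monoid using (×-homo-+; ×-congˡ) renaming (_×_ to _·_)
  open Congruence

  module _ {p} {P : Pred Carrier p} (P? : ∀ x → Dec (P x)) (P-resp : ∀ {x y} → x ≈ y → P x → P y) where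
    any? : Dec (∃[ x ] P x)
    any? = map′ (λ (i , p) → from i , p) (λ (x , p) → to x , P-resp (G.sym (strictlyInverseʳ x)) p)
      (Fin.any? λ i → P? (from i))

    all-or-counterexample : (∀ x → P x) ⊎ (∃[ x ] (¬ P x))
    all-or-counterexample with Fin.any? (λ i → ¬? (P? (from i)))
    ... | yes (i , ¬p) = inj₂ (from i , ¬p)
    ... | no  h        = inj₁ λ x → P-resp (strictlyInverseʳ x) (decidable-stable (P? (from (to x))) λ ¬p → h (to x , ¬p))

  finite-order : ∀ d → ∃[ o ] suc o · d ≈ ε
  finite-order d with Fin.pigeonhole (n<1+n n) (λ i → to (toℕ i · d))
  ... | i , j , i<j , e = toℕ j ∸ suc (toℕ i) , ∙-cancelˡ (toℕ i · d) _ _ (begin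
    toℕ i · d ∙ suc (toℕ j ∸ suc (toℕ i)) · d  ≈⟨ ×-homo-+ d (toℕ i) _ ⟨
    (toℕ i + suc (toℕ j ∸ suc (toℕ i))) · d    ≈⟨ ×-congˡ (trans (+-suc (toℕ i) _) (m+[n∸m]≡n i<j)) ⟩
    toℕ j · d                                  ≈⟨ strictlyInverseʳ (toℕ j · d) ⟨
    from (to (toℕ j · d))                      ≡⟨ cong from e ⟨
    from (to (toℕ i · d))                      ≈⟨ strictlyInverseʳ (toℕ i · d) ⟩
    toℕ i · d                                  ≈⟨ G.identityʳ (toℕ i · d) ⟨
    toℕ i · d ∙ ε                              ∎)
    where
    open SetoidReasoning G.setoid
    open AbelianGroupProperties G using (∙-cancelˡ)

  infixl 6 _⊕⟨_⟩
  _⊕⟨_⟩ : Congruence G → Carrier → Congruence G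
  κ ⊕⟨ d ⟩ = adjoin G κ d (proj₁ (finite-order d)) (proj₂ (finite-order d))

  ~⇒⊕⟨⟩ : ∀ κ d {x y} → _~_ κ x y → _~_ (κ ⊕⟨ d ⟩) x y
  ~⇒⊕⟨⟩ κ d = ~⇒adjoin G κ d (proj₁ (finite-order d)) (proj₂ (finite-order d))

  ⊕⟨⟩-∋ : ∀ κ d → _~_ (κ ⊕⟨ d ⟩) d ε
  ⊕⟨⟩-∋ κ d = adjoin-d G κ d (proj₁ (finite-order d)) (proj₂ (finite-order d))

  ∑ : (Carrier → ℕ) → ℕ
  ∑ f = sum (λ i → f (from i))

  ∑-translate : ∀ (f : Carrier → ℕ) → (∀ {x y} → x ≈ y → f x ≡ f y) → ∀ a → ∑ (λ x → f (x ∙ a)) ≡ ∑ f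
  ∑-translate f f-cong a = sym (trans (sum-permute (f ∘ from) π) (sum-cong-≗ {n} λ i → f-cong (strictlyInverseʳ (from i ∙ a))))
    where
    shift : Carrier → Fin n → Fin n
    shift b i = to (from i ∙ b)
    shift-inverse : ∀ a b → a ∙ b ≈ ε → ∀ i → shift b (shift a i) ≡ i
    shift-inverse a b ab≈ε i = trans (to-cong (G.trans (G.∙-congʳ (strictlyInverseʳ _))
      (G.trans (G.assoc _ a b) (G.trans (G.∙-congˡ ab≈ε) (G.identityʳ _))))) (strictlyInverseˡ i)
    π : Permutation n n
    π = permutation (shift a) (shift (a ⁻¹)) (shift-inverse (a ⁻¹) a (G.inverseˡ a)) (shift-inverse a (a ⁻¹) (G.inverseʳ a))

  ∑-count : ∀ {p} {P : Carrier → Pred Carrier p} (P? : ∀ x y → Dec (P x y)) {k} l →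
            All (λ y → ∑ (λ x → 𝟙 (P? x y)) ≡ k) l → ∑ (λ x → count (P? x) l) ≡ length l * k
  ∑-count P? []      []       = zeros n
    where
    zeros : ∀ n → sum {n} (λ _ → 0) ≡ 0
    zeros zero    = refl
    zeros (suc n) = zeros n
  ∑-count P? (y ∷ l) (e ∷ es) = trans (∑-distrib-+ (λ i → 𝟙 (P? (from i) y)) (λ i → count (P? (from i)) l))
    (cong₂ _+_ e (∑-count P? l es))

  q : ℕ
  q = ∑ (λ x → 𝟙 (T? x))

  -- Choosing the element d

  module _ (κ : Congruence G) where
    private
      open module κ = Congruence κ using () renaming (_~_ to infix 4 _∼_; _~?_ to infix 4 _∼?_)

    -- x ∈ T + K, where K is the subgroup of κ
    Near : Pred Carrier (c ⊔ ℓ ⊔ s)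
    Near x = ∃[ t ] (T t × x ∼ t)

    near? : ∀ x → Dec (Near x)
    near? x = any? (λ t → T? t ×-dec x ∼? t) (λ t≈t′ (Tt , x∼t) → T-resp t≈t′ Tt , κ.~-trans x∼t (κ.≈⇒~ t≈t′))

    near-resp : ∀ {x y} → x ∼ y → Near y → Near x
    near-resp x∼y (t , Tt , y∼t) = t , Tt , κ.~-trans x∼y y∼t

    -- Answering l by t ~ l ∙ d takes d off the difference between the robber and a cop.
    Guarded : Carrier → Pred Carrier (c ⊔ ℓ ⊔ s)
    Guarded d l = Near (l ∙ d)

    guarded? : ∀ d l → Dec (Guarded d l)
    guarded? d l = near? (l ∙ d)

    unguarded : Carrier → List Carrier → List Carrier
    unguarded d = filter (¬? ∘ guarded? d)

    Distinct : List Carrier → Set (c ⊔ ℓ)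
    Distinct = AllPairs λ x y → ¬ x ∼ y

    count-∼-≤ : ∀ g {l} → Distinct l → All T l → count (g ∼?_) l ≤ 𝟙 (near? g)
    count-∼-≤ g [] [] = z≤n
    count-∼-≤ g {y ∷ l} (y≁l ∷ distinct) (Ty ∷ Tl) with g ∼? y
    ... | no  _   = count-∼-≤ g distinct Tl
    ... | yes g∼y = subst (λ z → 1 + z ≤ 𝟙 (near? g))
      (sym (count-none (g ∼?_) (All.map (λ y≁z g∼z → y≁z (κ.~-trans (κ.~-sym g∼y) g∼z)) y≁l)))
      (𝟙-yes (near? g) (y , Ty , g∼y))

    k j τ : ℕ
    k = ∑ (λ x → 𝟙 (x ∼? ε))
    j = ∑ (λ x → 𝟙 (¬? (x ∼? ε)))
    τ = ∑ (λ x → 𝟙 (near? x))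

    k+j≡n : k + j ≡ n
    k+j≡n = trans (sym (∑-distrib-+ (λ i → 𝟙 (from i ∼? ε)) (λ i → 𝟙 (¬? (from i ∼? ε)))))
      (trans (sum-cong-≗ {n} (λ i → 𝟙-¬ (from i ∼? ε))) (sum-1 n))

    q≤τ : q ≤ τ
    q≤τ = sum-mono-≤ λ i → 𝟙-mono (T? (from i)) (near? (from i)) λ Tx → from i , Tx , κ.~-refl

    -- The classes of the moves in l are disjoint subsets of T + K with k elements each.
    xk≤τ : ∀ {l} → Distinct l → All T l → length l * k ≤ τ
    xk≤τ {l} distinct Tl = subst (_≤ τ) (∑-count _∼?_ l (All.universal class-size l)) (sum-mono-≤ λ i → count-∼-≤ (from i) distinct Tl)
      where
      class-size : ∀ y → ∑ (λ x → 𝟙 (x ∼? y)) ≡ k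
      class-size y = trans
        (sym (∑-translate (λ x → 𝟙 (x ∼? y)) (λ e → 𝟙-cong (_ ∼? y) (_ ∼? y)
          (κ.~-trans (κ.~-sym (κ.≈⇒~ e))) (κ.~-trans (κ.≈⇒~ e))) y))
        (sum-cong-≗ {n} λ i → 𝟙-cong (from i ∙ y ∼? y) (from i ∼? ε)
          (λ h → κ.~-cancelʳ y _ _ (κ.~-trans h (κ.~-sym (κ.≈⇒~ (G.identityˡ y)))))
          (λ h → κ.~-trans (κ.~-∙-congʳ h) (κ.≈⇒~ (G.identityˡ y))))

    -- Double counting: for a fixed move y, y + d runs through the whole group with d and meets T +
    -- K in τ values.
    ∑-guarded : ∀ l → ∑ (λ d → count (guarded? d) l) ≡ length l * τ
    ∑-guarded l = ∑-count guarded? l (All.universal (λ y → trans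
      (sum-cong-≗ {n} λ i → 𝟙-cong (near? (y ∙ from i)) (near? (from i ∙ y))
        (near-resp (κ.≈⇒~ (G.comm _ _))) (near-resp (κ.≈⇒~ (G.comm _ _))))
      (∑-translate (λ x → 𝟙 (near? x)) (λ e → 𝟙-cong (near? _) (near? _)
        (near-resp (κ.≈⇒~ (G.sym e))) (near-resp (κ.≈⇒~ e))) y)) l)

    -- With x = `suc y` moves, all d together guard x τ moves. Elements of K guard everything but
    -- account for only x k ≤ τ of these, so (x - 1) τ ≥ (x - 1) q remain for the fewer than n
    -- others. This is why x - 1 and not x decays.
    greedy : ∀ {l y} → Distinct l → All T l → length l ≡ suc y → ∃[ g ] ¬ g ∼ ε →
             ∃[ d ] (¬ d ∼ ε × q * y ≤ n * count (guarded? d) l)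
    greedy {l} {y} distinct Tl len (g , g≁ε)
      with Fin.any? (λ i → ¬? (from i ∼? ε) ×-dec (q * y ≤? n * count (guarded? (from i)) l))
    ... | yes (i , h) = from i , h
    ... | no  none    = ⊥-elim (averaging n k j y q τ k+j≡n 1≤j (subst (λ x → x * k ≤ τ) len (xk≤τ distinct Tl)) q≤τ few)
      where
      open ≤-Reasoning
      1≤j : 1 ≤ j
      1≤j = ≤-trans (s≤s z≤n) (sum-mono-< {f = λ _ → 0} (λ _ → z≤n) (to g)
        (𝟙-yes (¬? (from (to g) ∼? ε)) λ h → g≁ε (κ.~-trans (κ.~-sym (κ.≈⇒~ (strictlyInverseʳ g))) h)))
      -- Failure of the bound is strict, which gains 1 for each of the j elements outside K; with j
      -- ≥ 1 this makes the summed inequality contradictory.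
      pointwise : ∀ i → n * count (guarded? (from i)) l + 𝟙 (¬? (from i ∼? ε)) ≤
                        𝟙 (from i ∼? ε) * (n * suc y) + 𝟙 (¬? (from i ∼? ε)) * (q * y)
      pointwise i with from i ∼? ε in eq
      ... | yes _ = +-mono-≤ (≤-trans (*-monoʳ-≤ n (subst (count (guarded? (from i)) l ≤_) len (count-≤-length (guarded? (from i)) l))) (m≤m+n _ 0)) z≤n
      ... | no ≁ε = begin
        n * count (guarded? (from i)) l + 1     ≡⟨ +-comm _ 1 ⟩
        suc (n * count (guarded? (from i)) l)   ≤⟨ ≰⇒> (λ h → none (i , ≁ε , h)) ⟩
        q * y                                   ≤⟨ m≤m+n _ 0 ⟩
        q * y + 0                               ∎
      few : n * (suc y * τ) + j ≤ k * (n * suc y) + j * (q * y)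
      few = begin
        n * (suc y * τ) + j
          ≡⟨ cong (λ z → n * z + j) (trans (cong (_* τ) (sym len)) (sym (∑-guarded l))) ⟩
        n * ∑ (λ d → count (guarded? d) l) + j
          ≡⟨ cong (_+ j) (*-distribˡ-sum n (λ i → count (guarded? (from i)) l)) ⟩
        ∑ (λ d → n * count (guarded? d) l) + j
          ≡⟨ ∑-distrib-+ (λ i → n * count (guarded? (from i)) l) (λ i → 𝟙 (¬? (from i ∼? ε))) ⟨
        ∑ (λ d → n * count (guarded? d) l + 𝟙 (¬? (d ∼? ε)))
          ≤⟨ sum-mono-≤ pointwise ⟩
        ∑ (λ d → 𝟙 (d ∼? ε) * (n * suc y) + 𝟙 (¬? (d ∼? ε)) * (q * y))
          ≡⟨ ∑-distrib-+ (λ i → 𝟙 (from i ∼? ε) * (n * suc y)) (λ i → 𝟙 (¬? (from i ∼? ε)) * (q * y)) ⟩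
        ∑ (λ d → 𝟙 (d ∼? ε) * (n * suc y)) + ∑ (λ d → 𝟙 (¬? (d ∼? ε)) * (q * y))
          ≡⟨ cong₂ _+_ (*-distribʳ-sum (n * suc y) (λ i → 𝟙 (from i ∼? ε))) (*-distribʳ-sum (q * y) (λ i → 𝟙 (¬? (from i ∼? ε)))) ⟨
        k * (n * suc y) + j * (q * y) ∎

    -- Take d = t - y for some t in T outside the class of y. If there were none, T would lie in a
    -- single class, that of 0, and could not generate G.
    guard-one : ∀ {y l} → ∃[ g ] ¬ g ∼ ε → ∃[ d ] (¬ d ∼ ε × length (unguarded d (y ∷ l)) ≤ length l)
    guard-one {y} {l} (g , g≁ε)
      with any? (λ t → T? t ×-dec ¬? (t ∼? y)) (λ t≈t′ (Tt , t≁y) → T-resp t≈t′ Tt , λ t′∼y → t≁y (κ.~-trans (κ.≈⇒~ t≈t′) t′∼y))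
    ... | yes (t , Tt , t≁y) = t ∙ y ⁻¹ , (λ ty⁻¹∼ε → t≁y (κ.~-trans (κ.≈⇒~ (G.sym ty⁻¹y≈t)) (κ.~-trans (κ.~-∙-congʳ ty⁻¹∼ε) (κ.≈⇒~ (G.identityˡ y)))))
      , ≤-pred (filter-notAll (¬? ∘ guarded? (t ∙ y ⁻¹)) (y ∷ l) (here λ unguarded → unguarded
          (t , Tt , κ.≈⇒~ (G.trans (G.comm y (t ∙ y ⁻¹)) ty⁻¹y≈t))))
      where
      ty⁻¹y≈t : t ∙ y ⁻¹ ∙ y ≈ t
      ty⁻¹y≈t = G.trans (G.assoc t (y ⁻¹) y) (G.trans (G.∙-congˡ (G.inverseˡ y)) (G.identityʳ t))
    ... | no none = ⊥-elim (g≁ε (T-generates κ (λ Tt → κ.~-trans (T∼y Tt) (κ.~-sym (T∼y T-ε))) g))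
      where
      T∼y : ∀ {t} → T t → t ∼ y
      T∼y {t} Tt = decidable-stable (t ∼? y) λ t≁y → none (t , Tt , t≁y)

    guarded-by-pair : ∀ {x y} → T y → Guarded ((x ∙ y) ⁻¹) x
    guarded-by-pair {x} {y} Ty = y ⁻¹ , T-⁻¹ Ty , κ.x~zy⇒xy⁻¹~z
      (κ.≈⇒~ (G.sym (G.trans (G.∙-congˡ (G.comm x y)) (G.trans (G.sym (G.assoc (y ⁻¹) y x)) (G.trans (G.∙-congʳ (G.inverseˡ y)) (G.identityˡ x))))))

    guarded-by-pair′ : ∀ {x y} → T x → Guarded ((x ∙ y) ⁻¹) y
    guarded-by-pair′ {x} {y} Tx = near-resp (κ.≈⇒~ (G.∙-congˡ (G.⁻¹-cong (G.comm x y)))) (guarded-by-pair Tx)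

    inverse-≁ : ∀ {x} → ¬ x ∼ ε → ¬ x ⁻¹ ∼ ε
    inverse-≁ x≁ε x⁻¹∼ε = x≁ε (κ.~-⁻¹-injective (κ.~-trans x⁻¹∼ε (κ.~-sym κ.~-ε⁻¹)))

    -- Of x + y and x + z at most one lies in K, since otherwise y ~ z. Hence three distinct moves
    -- always contain a usable pair.
    guard-two : ∀ {x y z l} → Distinct (x ∷ y ∷ z ∷ l) → All T (x ∷ y ∷ z ∷ l) →
                ∃[ d ] (¬ d ∼ ε × length (unguarded d (x ∷ y ∷ z ∷ l)) ≤ suc (length l))
    guard-two {x} {y} {z} {l} (_ ∷ (y≁z ∷ _) ∷ _) (Tx ∷ Ty ∷ Tz ∷ _) with x ∙ y ∼? ε | x ∙ z ∼? ε
    ... | no xy≁ε | _ = (x ∙ y) ⁻¹ , inverse-≁ xy≁ε , (begin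
      length (filter F (x ∷ y ∷ z ∷ l))  ≡⟨ cong length (filter-reject F (λ u → u (guarded-by-pair Ty))) ⟩
      length (filter F (y ∷ z ∷ l))      ≡⟨ cong length (filter-reject F (λ u → u (guarded-by-pair′ Tx))) ⟩
      length (filter F (z ∷ l))          ≤⟨ length-filter F (z ∷ l) ⟩
      suc (length l)                     ∎)
      where
      open ≤-Reasoning
      F = ¬? ∘ guarded? ((x ∙ y) ⁻¹)
    ... | yes _ | no xz≁ε = (x ∙ z) ⁻¹ , inverse-≁ xz≁ε , (begin
      length (filter F (x ∷ y ∷ z ∷ l))  ≡⟨ cong length (filter-reject F (λ u → u (guarded-by-pair Tz))) ⟩
      length (filter F (y ∷ z ∷ l))      ≤⟨ ≤-pred (filter-notAll F (y ∷ z ∷ l) (there (here λ u → u (guarded-by-pair′ Tx)))) ⟩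
      suc (length l)                     ∎)
      where
      open ≤-Reasoning
      F = ¬? ∘ guarded? ((x ∙ z) ⁻¹)
    ... | yes xy∼ε | yes xz∼ε = ⊥-elim (y≁z (κ.~-cancelˡ x y z (κ.~-trans xy∼ε (κ.~-sym xz∼ε))))

  adjoin-decreases : ∀ κ d → ¬ _~_ κ d ε → j (κ ⊕⟨ d ⟩) < j κ
  adjoin-decreases κ d d≁ε = sum-mono-<
    (λ i → 𝟙-mono (¬? (from i ≋? ε)) (¬? (from i ~?κ ε)) λ ≉ε ~ε → ≉ε (~⇒⊕⟨⟩ κ d ~ε))
    (to d)
    -- The indicator at d drops to 0, seen by comparing it with the indicator of a decided `⊥`.
    (≤-trans (s≤s (≤-reflexive (𝟙-cong (¬? (from (to d) ≋? ε)) (no (λ (b : ⊥) → b))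
        (λ ≉ε → ≉ε (~-trans (κ ⊕⟨ d ⟩) (≈⇒~ (κ ⊕⟨ d ⟩) (strictlyInverseʳ d)) (⊕⟨⟩-∋ κ d))) ⊥-elim)))
      (𝟙-yes (¬? (from (to d) ~?κ ε)) λ h → d≁ε (~-trans κ (≈⇒~ κ (G.sym (strictlyInverseʳ d))) h)))
    where
    open Congruence (κ ⊕⟨ d ⟩) using () renaming (_~?_ to _≋?_)
    open Congruence κ using () renaming (_~?_ to _~?κ_)

  -- D i is the position of the robber minus that of the i-th cop. The cops can force
  -- one of these differences to be ~ ε as long as the robber only makes moves from U.
  data Win (κ : Congruence G) (U : Pred Carrier (c ⊔ ℓ)) {m} : (Fin m → Carrier) → Set (c ⊔ ℓ ⊔ s) where
    now  : ∀ {D} i → _~_ κ (D i) ε → Win κ U D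
    step : ∀ {D} (response : ∀ u → T u → U u → Fin m → Carrier) → (∀ u Tu Uu i → T (response u Tu Uu i)) →
           (∀ u Tu Uu → Win κ U (λ i → D i ∙ u ∙ response u Tu Uu i ⁻¹)) → Win κ U D

  Win-⊆ : ∀ {κ U V m} {D : Fin m → Carrier} → (∀ {u} → V u → U u) → Win κ U D → Win κ V D
  Win-⊆ V⊆U (now i e)      = now i e
  Win-⊆ V⊆U (step r legal w) = step (λ u Tu Vu → r u Tu (V⊆U Vu)) (λ u Tu Vu → legal u Tu (V⊆U Vu))
    (λ u Tu Vu → Win-⊆ V⊆U (w u Tu (V⊆U Vu)))

  -- Moves are restricted only modulo K, so one representative per class is enough.
  Allowed : Congruence G → List Carrier → Pred Carrier (c ⊔ ℓ)
  Allowed κ l u = Any (_~_ κ u) l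

  -- Spending one cop on the moves guarded by d

  module _ (κ : Congruence G) (d : Carrier) (l : List Carrier) {m : ℕ}
    (w : ∀ (D : Fin m → Carrier) → Win κ (Allowed κ (unguarded κ d l)) D) where
    private
      open module κ = Congruence κ using () renaming (_~_ to infix 4 _∼_)

      open SetoidReasoning κ.~-setoid
      open CommutativeSemigroupProperties (AbelianGroup.commutativeSemigroup G) using (xy∙z≈y∙zx)

      split : ∀ u → Allowed κ l u → Guarded κ d u ⊎ Allowed κ (unguarded κ d l) u
      split u u∈l with Any.filter⁺ (¬? ∘ guarded? κ d) u∈l
      ... | inj₁ u∈l′ = inj₂ u∈l′
      ... | inj₂ ¬¬g  = inj₁ (near-resp κ (κ.~-∙-congʳ (Any.lookup-result u∈l))
        (decidable-stable (guarded? κ d (Any.lookup u∈l)) ¬¬g))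

      -- While the robber makes a move that cop i does not guard, cop i copies it and
      -- the other cops follow w; a guarded move brings cop i one multiple of d closer.
      module _ (k : ℕ) (i : Fin (suc m)) (closer : ∀ D → D i ∼ k · d → Win κ (Allowed κ l) D) where
        respond : (∀ u → T u → Allowed κ (unguarded κ d l) u → Fin m → Carrier) →
                  ∀ u → T u → Guarded κ d u ⊎ Allowed κ (unguarded κ d l) u → Fin (suc m) → Carrier
        -- The other cops can stand still: `closer` accepts every position with the right i-th
        -- difference.
        respond r u Tu (inj₁ (t , _)) = insertAt (λ _ → ε) i t
        respond r u Tu (inj₂ u∈l′)    = insertAt (r u Tu u∈l′) i u

        insertAt-T : ∀ (f : Fin m → Carrier) x → (∀ i → T (f i)) → T x → ∀ i′ → T (insertAt f i x i′)
        insertAt-T f x Tf Tx i′ with i Fin.≟ i′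
        ... | yes refl = subst T (sym (insertAt-lookup f i x)) Tx
        ... | no  i≢i′ = subst T (sym (trans (cong (insertAt f i x) (sym (Fin.punchIn-punchOut i≢i′))) (insertAt-punchIn f i x _))) (Tf _)

        -- Induction on the win of the other cops. Their differences E are kept apart from D,
        -- because after `insertAt` the two agree only pointwise and up to `≈`.
        hold : ∀ {E : Fin m → Carrier} → Win κ (Allowed κ (unguarded κ d l)) E → ∀ D →
               (∀ i′ → D (punchIn i i′) ≈ E i′) → D i ∼ suc k · d → Win κ (Allowed κ l) D
        hold (now i′ e) D D≈E _ = now (punchIn i i′) (κ.~-trans (κ.≈⇒~ (D≈E i′)) e)
        hold {E} (step r legal next) D D≈E Di = step
          (λ u Tu u∈l → respond r u Tu (split u u∈l))
          (λ u Tu u∈l → respond-legal u Tu (split u u∈l))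
          (λ u Tu u∈l → continue u Tu (split u u∈l))
          where
          respond-legal : ∀ u Tu x i′ → T (respond r u Tu x i′)
          respond-legal u Tu (inj₁ (t , Tt , _)) = insertAt-T (λ _ → ε) t (λ _ → T-ε) Tt
          respond-legal u Tu (inj₂ u∈l′)         = insertAt-T (r u Tu u∈l′) u (legal u Tu u∈l′) Tu
          continue : ∀ u Tu x → Win κ (Allowed κ l) (λ i′ → D i′ ∙ u ∙ respond r u Tu x i′ ⁻¹)
          continue u Tu (inj₁ (t , Tt , ud∼t)) = closer _ (begin
            D i ∙ u ∙ insertAt (λ _ → ε) i t i ⁻¹   ≡⟨ cong (λ x → D i ∙ u ∙ x ⁻¹) (insertAt-lookup (λ _ → ε) i t) ⟩
            D i ∙ u ∙ t ⁻¹                          ≈⟨ κ.x~zy⇒xy⁻¹~z (begin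
              D i ∙ u                                 ≈⟨ κ.~-∙-congʳ Di ⟩
              d ∙ k · d ∙ u                           ≈⟨ κ.≈⇒~ (xy∙z≈y∙zx d (k · d) u) ⟩
              k · d ∙ (u ∙ d)                         ≈⟨ κ.~-∙-congˡ ud∼t ⟩
              k · d ∙ t                               ∎) ⟩
            k · d                                   ∎)
          continue u Tu (inj₂ u∈l′) = hold (next u Tu u∈l′) _
            (λ i′ → G.trans (G.∙-congˡ (G.⁻¹-cong (G.reflexive (insertAt-punchIn (r u Tu u∈l′) i u i′)))) (G.∙-congʳ (G.∙-congʳ (D≈E i′))))
            (begin
            D i ∙ u ∙ insertAt (r u Tu u∈l′) i u i ⁻¹   ≡⟨ cong (λ x → D i ∙ u ∙ x ⁻¹) (insertAt-lookup (r u Tu u∈l′) i u) ⟩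
            D i ∙ u ∙ u ⁻¹                              ≈⟨ κ.x~zy⇒xy⁻¹~z κ.~-refl ⟩
            D i                                         ≈⟨ Di ⟩
            suc k · d                                   ∎)

      -- Each guarded move lowers k and restarts `w` from wherever the other cops then are, which is
      -- why `w` must win from every D.
      descend : ∀ k i D → D i ∼ k · d → Win κ (Allowed κ l) D
      descend zero    i D Di = now i Di
      descend (suc k) i D Di = hold k i (descend k i) (w (λ i′ → D (punchIn i i′))) D (λ _ → G.refl) Di

    -- A win modulo K + ⟨d⟩ ends with some difference k d modulo K, where `descend` takes over.
    -- Until then the responses carry over, since moves allowed modulo K stay allowed modulo the
    -- larger subgroup.
    adjoin-win : ∀ {D : Fin (suc m) → Carrier} → Win (κ ⊕⟨ d ⟩) (Allowed (κ ⊕⟨ d ⟩) l) D → Win κ (Allowed κ l) D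
    adjoin-win (now i (k , e)) = descend k i _ (κ.~-trans e (κ.≈⇒~ (G.identityˡ (k · d))))
    adjoin-win (step r legal next) = step
      (λ u Tu u∈l → r u Tu (Any.map (~⇒⊕⟨⟩ κ d) u∈l))
      (λ u Tu u∈l → legal u Tu (Any.map (~⇒⊕⟨⟩ κ d) u∈l))
      (λ u Tu u∈l → adjoin-win (next u Tu (Any.map (~⇒⊕⟨⟩ κ d) u∈l)))

  -- How many cops win

  decayed : ∀ {x y gain} t m → .{{NonZero n}} → x + gain ≡ suc y → q ≤ n → q * y ≤ n * gain →
            y * (n ∸ q) ^ suc t ≤ 2 * m * n ^ suc t → pred x * (n ∸ q) ^ t ≤ 2 * m * n ^ t
  decayed {zero}  t m _ _ _ _ = z≤n
  decayed {suc x} {y} {gain} t m x+gain q≤n large h = *-cancelˡ-≤ n (begin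
    n * (x * p ^ t)         ≡⟨ *-assoc n x (p ^ t) ⟨
    n * x * p ^ t           ≤⟨ *-monoˡ-≤ (p ^ t) nx≤ ⟩
    p * y * p ^ t           ≡⟨ lemma p y (p ^ t) ⟩
    y * (p * p ^ t)         ≤⟨ h ⟩
    2 * m * (n * n ^ t)     ≡⟨ lemma′ (2 * m) n (n ^ t) ⟩
    n * (2 * m * n ^ t)     ∎)
    where
    open ≤-Reasoning
    p = n ∸ q
    lemma : ∀ p y z → p * y * z ≡ y * (p * z)
    lemma = solve-∀
    lemma′ : ∀ m n z → m * (n * z) ≡ n * (m * z)
    lemma′ = solve-∀
    -- Here x is the new number of moves less one, so x = y - gain with n gain ≥ q y.
    nx≤ : n * x ≤ p * y
    nx≤ = +-cancelʳ-≤ (n * gain) (n * x) (p * y) (begin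
      n * x + n * gain     ≡⟨ *-distribˡ-+ n x gain ⟨
      n * (x + gain)       ≡⟨ cong (n *_) (suc-injective x+gain) ⟩
      n * y                ≡⟨ cong (_* y) (m∸n+n≡m q≤n) ⟨
      (p + q) * y          ≡⟨ *-distribʳ-+ y p q ⟩
      p * y + q * y        ≤⟨ +-monoʳ-≤ (p * y) large ⟩
      p * y + n * gain     ∎)

  q≤n : q ≤ n
  q≤n = ≤-trans (sum-mono-≤ (λ i → 𝟙≤1 (T? (from i)))) (≤-reflexive (sum-1 n))
    where
    𝟙≤1 : ∀ {p} {P : Set p} (P? : Dec P) → 𝟙 P? ≤ 1
    𝟙≤1 P? = 𝟙-mono P? (yes P?) (λ _ → P?)

  1≤q : 1 ≤ q
  1≤q = ≤-trans (s≤s z≤n) (sum-mono-< {f = λ _ → 0} (λ _ → z≤n) (to ε)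
    (𝟙-yes (T? (from (to ε))) (T-resp (G.sym (strictlyInverseʳ ε)) T-ε)))

  -- A game without allowed moves counts as won, even without cops: staying put is a move too, and
  -- in `hold` every excluded move brings the guarding cop closer.
  Win-[] : ∀ {κ l m} {D : Fin m → Carrier} → length l ≤ 0 → Win κ (Allowed κ l) D
  Win-[] {l = []} _ = step (λ _ _ ()) (λ _ _ ()) (λ _ _ ())

  length-deduplicate : ∀ (κ : Congruence G) l → length (deduplicate (_~?_ κ) l) ≤ length l
  length-deduplicate κ []      = z≤n
  length-deduplicate κ (x ∷ l) = s≤s (≤-trans (length-filter _ (deduplicate (_~?_ κ) l)) (length-deduplicate κ l))

  module _ {{n≢0 : NonZero n}} where
    -- Induction on b, which bounds the number of elements outside K, and within it on t and then m.
    -- Moves may coincide modulo a larger subgroup, so `win-bounded` first removes repetitions; this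
    -- only shortens the list and preserves the inequality. `win-distinct` then spends a cop.
    win-bounded : ∀ b κ → j κ ≤ b → ∀ t m l → All T l → pred (length l) * (n ∸ q) ^ t ≤ 2 * m * n ^ t →
                  (D : Fin (suc (t + m)) → Carrier) → Win κ (Allowed κ l) D
    win-distinct : ∀ b κ → j κ ≤ b → ∃[ g ] ¬ _~_ κ g ε → ∀ t m l → Distinct κ l → All T l →
                   pred (length l) * (n ∸ q) ^ t ≤ 2 * m * n ^ t →
                   (D : Fin (suc (t + m)) → Carrier) → Win κ (Allowed κ l) D

    win-bounded b κ j≤b t m l Tl h D
      with all-or-counterexample (λ g → _~?_ κ g ε) (λ x≈y x~ε → ~-trans κ (≈⇒~ κ (G.sym x≈y)) x~ε)
    ... | inj₁ trivial    = now zero (trivial (D zero))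
    ... | inj₂ nontrivial = Win-⊆ (Any.deduplicate⁺ (_~?_ κ) (λ y~x u~x → ~-trans κ u~x (~-sym κ y~x)))
      (win-distinct b κ j≤b nontrivial t m (deduplicate (_~?_ κ) l) (Unique.deduplicate-! decSetoid l) (All.deduplicate⁺ (_~?_ κ) Tl)
        (≤-trans (*-monoˡ-≤ ((n ∸ q) ^ t) (pred-mono-≤ {length (deduplicate (_~?_ κ) l)} {length l} (length-deduplicate κ l))) h) D)
      where
      decSetoid : DecSetoid c ℓ
      decSetoid = record { isDecEquivalence = record { isEquivalence = AbelianGroup.isEquivalence (quotient κ) ; _≟_ = _~?_ κ } }

    win-distinct b κ j≤b nontrivial t m [] _ _ _ D = Win-[] {κ} {[]} z≤n
    win-distinct zero κ j≤b (g , g≁ε) t m (x ∷ l) _ _ _ D = ⊥-elim (n≮0 (≤-trans (adjoin-decreases κ g g≁ε) j≤b))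
    win-distinct (suc b) κ j≤b nontrivial (suc t) m l@(_ ∷ _) distinct Tl h D =
      let (d , d≁ε , large) = greedy κ distinct Tl refl nontrivial
          F = ¬? ∘ guarded? κ d
      in adjoin-win κ d l
        (win-distinct (suc b) κ j≤b nontrivial t m (unguarded κ d l) (AllPairs.filter⁺ F distinct) (All.filter⁺ F Tl)
          (decayed {length (unguarded κ d l)} t m (filter-count (guarded? κ d) l) q≤n large h))
        (win-bounded b (κ ⊕⟨ d ⟩) (≤-pred (≤-trans (adjoin-decreases κ d d≁ε) j≤b)) (suc t) m l Tl h D)
    win-distinct (suc b) κ j≤b nontrivial zero m l@(x ∷ l′) distinct Tl h D = choose m l distinct Tl h D
      where
      use : ∀ m l → All T l → pred (length l) * 1 ≤ 2 * m * 1 → ∀ d → ¬ _~_ κ d ε →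
            (∀ D → Win κ (Allowed κ (unguarded κ d l)) {m} D) → (D : Fin (suc m) → Carrier) → Win κ (Allowed κ l) D
      use m l Tl h d d≁ε w D = adjoin-win κ d l w
        (win-bounded b (κ ⊕⟨ d ⟩) (≤-pred (≤-trans (adjoin-decreases κ d d≁ε) j≤b)) 0 m l Tl h D)
      choose : ∀ m l → Distinct κ l → All T l → pred (length l) * 1 ≤ 2 * m * 1 →
               (D : Fin (suc m) → Carrier) → Win κ (Allowed κ l) D
      choose m [] _ _ _ D = Win-[] {κ} {[]} z≤n
      choose zero l@(x ∷ []) distinct Tl h =
        let (d , d≁ε , len) = guard-one κ {x} {[]} nontrivial in use 0 l Tl h d d≁ε (λ D → Win-[] len)
      choose (suc m) l@(x ∷ y ∷ z ∷ l′) distinct Tl h =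
        let (d , d≁ε , len) = guard-two κ distinct Tl
            F = ¬? ∘ guarded? κ d
        in use (suc m) l Tl h d d≁ε (choose m (unguarded κ d l) (AllPairs.filter⁺ F distinct) (All.filter⁺ F Tl)
          (*-monoˡ-≤ 1 (≤-trans (pred-mono-≤ len) (≤-pred (≤-pred (subst (suc (suc (length l′)) ≤_) (*-suc 2 m) (*-cancelʳ-≤ _ _ 1 h)))))))
      choose (suc m) l@(x ∷ []) distinct Tl h =
        let (d , d≁ε , len) = guard-one κ {x} {[]} nontrivial in use (suc m) l Tl h d d≁ε (λ D → Win-[] len)
      -- With two moves x + y may lie in K, so only one is guarded; the single remaining move needs
      -- no further pair.
      choose (suc m) l@(x ∷ y ∷ []) distinct Tl h =
        let (d , d≁ε , len) = guard-one κ {x} {y ∷ []} nontrivial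
            F = ¬? ∘ guarded? κ d
        in use (suc m) l Tl h d d≁ε (choose m (unguarded κ d l) (AllPairs.filter⁺ F distinct) (All.filter⁺ F Tl)
          (≤-trans (*-monoˡ-≤ 1 (pred-mono-≤ len)) z≤n))

-- The game on the Cayley graph

¬¬-Dec-∀ : ∀ {n p} (P : Pred (Fin n) p) → ¬ ¬ (∀ i → Dec (P i))
¬¬-Dec-∀ P = Fin.sequence (RawMonad.rawApplicative ¬¬-Monad) (λ _ → ¬¬-excluded-middle)

length-filter-tabulate : ∀ {A : Set a} {P : Pred A b} (P? : ∀ x → Dec (P x)) {n} (f : Fin n → A) →
                         length (filter P? (tabulate f)) ≡ sum (λ i → 𝟙 (P? (f i)))
length-filter-tabulate P? {zero}  f = refl
length-filter-tabulate P? {suc n} f with P? (f zero)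
... | yes _ = cong suc (length-filter-tabulate P? (f ∘ suc))
... | no  _ = length-filter-tabulate P? (f ∘ suc)

module CayleyGame {g ℓ s} (G : AbelianGroup g ℓ) (n : ℕ) (enum : Inverse (AbelianGroup.setoid G) (setoid (Fin n)))
  (S : Pred (AbelianGroup.Carrier G) s) (isC : IsConnectionSet G S)
  (S? : ∀ x → Dec (S x)) where
  open AbelianGroup G using (Carrier; _≈_; _∙_; ε; _⁻¹)
  private
    module G = AbelianGroup G
  open Inverse enum using (to; from; strictlyInverseʳ)
  open IsConnectionSet isC
  open AbelianGroupProperties G using (ε⁻¹≈ε; //-rightDividesˡ; ⁻¹-∙-comm; x∙y⁻¹≈ε⇒x≈y)
  open SetoidReasoning G.setoid

  Γ : Graph g ℓ s
  Γ = Cay G S isC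

  T : Pred Carrier (ℓ ⊔ s)
  T x = x ≈ ε ⊎ S x

  _≈?_ : Decidable _≈_
  x ≈? y = map′ (λ e → G.trans (G.sym (strictlyInverseʳ x)) (G.trans (G.reflexive (cong from e)) (strictlyInverseʳ y)))
    (Inverse.to-cong enum) (to x Fin.≟ to y)

  T? : ∀ x → Dec (T x)
  T? x = (x ≈? ε) ⊎-dec S? x

  T-resp : ∀ {x y} → x ≈ y → T x → T y
  T-resp x≈y (inj₁ x≈ε) = inj₁ (G.trans (G.sym x≈y) x≈ε)
  T-resp x≈y (inj₂ Sx)  = inj₂ (respects x≈y Sx)

  T-⁻¹ : ∀ {x} → T x → T (x ⁻¹)
  T-⁻¹ (inj₁ x≈ε) = inj₁ (G.trans (G.⁻¹-cong x≈ε) ε⁻¹≈ε)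
  T-⁻¹ (inj₂ Sx)  = inj₂ (proj₂ symmetric (_ , Sx , G.refl))

  T-generates : Generates G T
  T-generates κ T~ε x = ⟨S⟩~ε (generating x)
    where
    open Congruence κ
    ⟨S⟩~ε : ∀ {x} → ⟨_⟩ G S x → x ~ ε
    ⟨S⟩~ε (gen Sx)     = T~ε (inj₂ Sx)
    ⟨S⟩~ε unit         = ~-refl
    ⟨S⟩~ε (mul hx hy)  = ~-trans (~-∙-cong (⟨S⟩~ε hx) (⟨S⟩~ε hy)) (≈⇒~ (G.identityˡ ε))
    ⟨S⟩~ε (inv hx)     = ~-trans (~-⁻¹-cong (⟨S⟩~ε hx)) (≈⇒~ ε⁻¹≈ε)
    ⟨S⟩~ε (resp x≈y hx) = ~-trans (≈⇒~ (G.sym x≈y)) (⟨S⟩~ε hx)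

  open Pursuit G n enum T T? T-resp (inj₁ G.refl) T-⁻¹ T-generates

  equality : Congruence G
  equality = record { _~_ = _≈_ ; ~-isAbelianGroup = G.isAbelianGroup ; ≈⇒~ = id ; _~?_ = _≈?_ }

  moves : List Carrier
  moves = filter T? (tabulate from)

  moves-complete : ∀ {u} → T u → Allowed equality moves u
  moves-complete {u} Tu = [ id , (λ ¬T → ⊥-elim (¬T (T-resp (Any.lookup-result u∈G) Tu))) ]′ (Any.filter⁺ T? u∈G)
    where
    u∈G : Any (u ≈_) (tabulate from)
    u∈G = Any.tabulate⁺ (to u) (G.sym (strictlyInverseʳ u))

  move⇒T : ∀ {x y} → Move Γ x y → T (y ∙ x ⁻¹)
  move⇒T {x} {y} (inj₁ x≈y) = inj₁ (G.trans (G.∙-congʳ (G.sym x≈y)) (G.inverseʳ x))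
  move⇒T (inj₂ adj) = inj₂ adj

  T⇒move : ∀ {t} x → T t → Move Γ x (t ∙ x)
  T⇒move {t} x (inj₁ t≈ε) = inj₁ (G.sym (G.trans (G.∙-congʳ t≈ε) (G.identityˡ x)))
  T⇒move {t} x (inj₂ St) = inj₂ (respects (G.sym (begin
    t ∙ x ∙ x ⁻¹     ≈⟨ G.assoc t x (x ⁻¹) ⟩
    t ∙ (x ∙ x ⁻¹)   ≈⟨ G.∙-congˡ (G.inverseʳ x) ⟩
    t ∙ ε            ≈⟨ G.identityʳ t ⟩
    t                ∎)) St)

  module _ {m : ℕ} (win : ∀ D → Win equality (Allowed equality moves) {m} D) where
    -- A strategy must answer every list of vertices; `over` absorbs illegal robber moves as well as
    -- finished games. `hunt` stores the robber's last position and the remaining win.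
    data Status (pos : Fin m → Carrier) : Set (g ⊔ ℓ ⊔ s) where
      opening : Status pos
      over  : Status pos
      hunt  : ∀ r D → (∀ i → D i ≈ r ∙ pos i ⁻¹) → Win equality (Allowed equality moves) D → Status pos

    Phase : Set (g ⊔ ℓ ⊔ s)
    Phase = ∃[ pos ] Status pos

    difference : ∀ r r′ p t D → D ≈ r ∙ p ⁻¹ → D ∙ (r′ ∙ r ⁻¹) ∙ t ⁻¹ ≈ r′ ∙ (t ∙ p) ⁻¹
    difference r r′ p t D D≈ = begin
      D ∙ (r′ ∙ r ⁻¹) ∙ t ⁻¹            ≈⟨ G.∙-congʳ (G.∙-congʳ D≈) ⟩
      r ∙ p ⁻¹ ∙ (r′ ∙ r ⁻¹) ∙ t ⁻¹     ≈⟨ G.∙-congʳ (G.comm (r ∙ p ⁻¹) (r′ ∙ r ⁻¹)) ⟩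
      r′ ∙ r ⁻¹ ∙ (r ∙ p ⁻¹) ∙ t ⁻¹     ≈⟨ G.∙-congʳ (G.assoc (r′ ∙ r ⁻¹) r (p ⁻¹)) ⟨
      r′ ∙ r ⁻¹ ∙ r ∙ p ⁻¹ ∙ t ⁻¹       ≈⟨ G.∙-congʳ (G.∙-congʳ (//-rightDividesˡ r r′)) ⟩
      r′ ∙ p ⁻¹ ∙ t ⁻¹                  ≈⟨ G.assoc r′ (p ⁻¹) (t ⁻¹) ⟩
      r′ ∙ (p ⁻¹ ∙ t ⁻¹)                ≈⟨ G.∙-congˡ (G.comm (p ⁻¹) (t ⁻¹)) ⟩
      r′ ∙ (t ⁻¹ ∙ p ⁻¹)                ≈⟨ G.∙-congˡ (⁻¹-∙-comm t p) ⟩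
      r′ ∙ (t ∙ p) ⁻¹                   ∎

    chase : ∀ r r′ pos {D} → (∀ i → D i ≈ r ∙ pos i ⁻¹) → Win equality (Allowed equality moves) D → Dec (T (r′ ∙ r ⁻¹)) → Phase
    chase r r′ pos     D≈ (now _ _)         _        = pos , over
    chase r r′ pos     D≈ (step _ _ _)      (no _)   = pos , over
    chase r r′ pos {D} D≈ (step f _ next)   (yes Tu) =
      let t = f (r′ ∙ r ⁻¹) Tu (moves-complete Tu)
      in (λ i → t i ∙ pos i) , hunt r′ _ (λ i → difference r r′ (pos i) (t i) (D i) (D≈ i)) (next (r′ ∙ r ⁻¹) Tu (moves-complete Tu))

    advance : Carrier → Phase → Phase
    -- The cops pass their first turn, because `Win` starts with a robber move.
    advance r′ (pos , opening)         = pos , hunt r′ _ (λ _ → G.refl) (win (λ i → r′ ∙ pos i ⁻¹))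
    advance r′ (pos , over)          = pos , over
    advance r′ (pos , hunt r D D≈ w) = chase r r′ pos D≈ w (T? (r′ ∙ r ⁻¹))

    advance-legal : ∀ r φ i → Move Γ (proj₁ φ i) (proj₁ (advance r φ) i)
    advance-legal r′ (pos , opening)         i = inj₁ G.refl
    advance-legal r′ (pos , over)          i = inj₁ G.refl
    advance-legal r′ (pos , hunt r D D≈ w) i = chase-legal w (T? (r′ ∙ r ⁻¹))
      where
      chase-legal : ∀ {D D≈} (w : Win equality (Allowed equality moves) D) T? → Move Γ (pos i) (proj₁ (chase r r′ pos D≈ w T?) i)
      chase-legal (now _ _)        _        = inj₁ G.refl
      chase-legal (step _ _ _)     (no _)   = inj₁ G.refl
      chase-legal (step f legal _) (yes Tu) = T⇒move (pos i) (legal (r′ ∙ r ⁻¹) Tu (moves-complete Tu) i)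

    run : List Carrier → Phase
    -- Any placement would do, as `win` covers all differences.
    run []      = (λ _ → ε) , opening
    run (r ∷ h) = advance r (run h)

    strategy : CopStrategy Γ m
    strategy = record { cops = λ h → proj₁ (run h) ; legal = λ r h → advance-legal r (run h) }

    module _ (ρ : RobberPlay Γ) where
      open RobberPlay ρ

      -- Induction on the remaining win w; the equation ties w to the state that the strategy
      -- computes from the history.
      catch : ∀ t {pos D D≈} w → run (history (suc t)) ≡ (pos , hunt (robber t) D D≈ w) → Caught Γ strategy ρ
      catch t {D≈ = D≈} (now i D~ε) eq = t , i , inj₂ (subst (λ φ → proj₁ φ i ≈ robber t) (sym eq)
        (G.sym (x∙y⁻¹≈ε⇒x≈y _ _ (G.trans (G.sym (D≈ i)) D~ε))))
      catch t {pos} {D≈ = D≈} w@(step f _ next) eq with T? (robber (suc t) ∙ robber t ⁻¹) in T?≡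
      ... | no ¬T  = ⊥-elim (¬T (move⇒T (legal t)))
      ... | yes Tu = catch (suc t) (next (robber (suc t) ∙ robber t ⁻¹) Tu (moves-complete Tu))
        (trans (cong (advance (robber (suc t))) eq) (cong (chase (robber t) (robber (suc t)) pos D≈ w) T?≡))

      caught : Caught Γ strategy ρ
      caught = catch 0 (win (λ i → robber 0 ∙ ε ⁻¹)) refl

    cops-win : CopsWin Γ m
    cops-win = strategy , caught

  cops-suffice : ∀ M j′ → 2 * n * j′ ! ≤ M * M * expNumerator j′ → CopsWin Γ (M + 2)
  cops-suffice M j′ large =
    let (m , t , cops , decay) = split-cops n q M j′ q≤n large
    in subst (CopsWin Γ) (trans (cong suc (+-comm t m)) cops)
         (cops-win (win-bounded (j equality) equality ≤-refl t m moves (All.all-filter T? (tabulate from))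
           (subst (λ x → pred x * (n ∸ q) ^ t ≤ 2 * m * n ^ t) (sym (length-filter-tabulate T? from)) decay)))
    where
    instance
      n≢0 : NonZero n
      n≢0 = ℕ.>-nonZero (≤-trans 1≤q q≤n)
      q≢0 : NonZero q
      q≢0 = ℕ.>-nonZero 1≤q

-- S need not be decidable, but finitely many instances of excluded middle are
-- available for proving the stable conclusion.
copNumber-bound : ∀ {g ℓ s} (G : AbelianGroup g ℓ) n → Inverse (AbelianGroup.setoid G) (setoid (Fin n)) →
  (S : Pred (AbelianGroup.Carrier G) s) (isC : IsConnectionSet G S) → ∀ c → IsCopNumber (Cay G S isC) c →
  ∀ j → (c ∸ 3) * (c ∸ 3) * expNumerator j ≤ 2 * n * j !
copNumber-bound G n enum S isC c (_ , minimal) j = decidable-stable (_ ≤? _) λ large →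
  ¬¬-Dec-∀ (S ∘ from) λ S? → large (absurd c minimal (ℕ.<⇒≤ (ℕ.≰⇒> large))
    (λ x → map′ (respects (strictlyInverseʳ x)) (respects (AbelianGroup.sym G (strictlyInverseʳ x))) (S? (to x))))
  where
  open Inverse enum using (to; from; strictlyInverseʳ)
  open IsConnectionSet isC
  absurd : ∀ c → (∀ k → CopsWin (Cay G S isC) k → c ≤ k) → 2 * n * j ! ≤ (c ∸ 3) * (c ∸ 3) * expNumerator j →
           (∀ x → Dec (S x)) → (c ∸ 3) * (c ∸ 3) * expNumerator j ≤ 2 * n * j !
  -- Here c = M + 3, and M + 2 cops would already win.
  absurd (suc (suc (suc M))) minimal large S? = ⊥-elim (ℕ.n≮n (M + 2)
    (subst (_≤ M + 2) (cong suc (+-comm 2 M)) (minimal (M + 2) (CayleyGame.cops-suffice G n enum S isC S? M j large))))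
  absurd zero                _ _ _ = z≤n
  absurd (suc zero)          _ _ _ = z≤n
  absurd (suc (suc zero))    _ _ _ = z≤n

proposition3p9 : ∀ {g ℓ s : Level} (G : AbelianGroup g ℓ) (n : ℕ)
    → Inverse (AbelianGroup.setoid G) (setoid (Fin n))
    → (S : Pred (AbelianGroup.Carrier G) s) (isC : IsConnectionSet G S)
    → (p : ℕ) → IsSmallestPrimeFactor p n
    → (c : ℕ) → IsCopNumber (Cay G S isC) c
    → (p ≡ 3 → fromℕ c ≤ℝ √ (fromℕ 3 ÷ℝ (fromℕ 2 *ℝ (√ fromℕ 3 -ℝ fromℕ 1) *ℝ 𝑒)) *ℝ √ fromℕ n +ℝ fromℚ (+ 7 / 2))
    × (5 ≤ p → fromℕ c ≤ℝ √ (fromℕ 2 ÷ℝ 𝑒) *ℝ √ fromℕ n +ℝ fromℚ (+ 7 / 2))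
proposition3p9 G n enum S isC p _ c isCop = (λ _ → √[3/2[√3-1]e]-bound (c ∸ 3) n c c≤ small) , (λ _ → √[2/e]-bound (c ∸ 3) n c c≤ small)
  where
  small = copNumber-bound G n enum S isC c isCop
  c≤ : c ≤ c ∸ 3 + 3
  c≤ = ≤-trans (m≤n+m∸n c 3) (≤-reflexive (+-comm 3 (c ∸ 3)))
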